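{- Let $X\in S_n$ be $k$-increasing (i.e. $X$ avoids the pattern $(k,k-1,\dots,1)$) or $k$-decreasing (i.e. $X$ avoids $(1,2,\dots,k)$). Then for an arbitrary initial tree $T$, the cost of \textsc{Greedy} satisfies $|\textsc{Greedy}_T(X)|\le n\,2^{O(k^2)}$.
   Context: $X$ contains $\pi\in S_k$ if some length-$k$ subsequence of $X$ is order-isomorphic to $\pi$; otherwise $X$ avoids $\pi$. Geometric BST model: $X=(x_1,\dots,x_n)$ is identified with access points $\{(x_t,t)\}$ (key, time). $\square_{pq}$ is the closed axis-parallel rectangle with corners $p,q$. An initial tree $T$ (BST on $[n]$ of depth $d$, root depth 1) is represented by the points $(x,s)$, $s=1-d,\dots,1-d(x)$, for each key $x$ of depth $d(x)$. \textsc{Greedy}: let $\tau(b,t)$ be the largest time $\le t$ at which column $b$ contains a point of $T$ or of the output so far (undefined if none). At time $t$ with access $(a,t)$, add $(a,t)$ and $(b,t)$ for each key $b\ne a$ with $\tau(b,t-1)$ defined such that $\square_{(a,t),(b,\tau(b,t-1))}$ contains no point of $T\cup\{$output points at times $<t\}$ other than $(b,\tau(b,t-1))$. The cost is $|\textsc{Greedy}_T(X)|$, the number of output points. -}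

module Defs where

open import Data.Bool using (Bool; true; false; _∧_; _∨_; not; if_then_else_)
open import Data.Nat as ℕ using (ℕ; zero; suc; _+_; _∸_; _⊔_; _⊓_; _<_; _≤_)
open import Data.Integer as ℤ using (ℤ; +_)
open import Data.Fin as Fin using (Fin; toℕ)
open import Data.Fin.Permutation using (Permutation′; _⟨$⟩ʳ_)
open import Data.List as List using (List; []; _∷_; _++_; map; length; allFin; applyUpTo; foldr; filter)
open import Data.List.Relation.Unary.All using (All)
open import Data.List.Membership.Propositional using (_∈_)
open import Data.Maybe using (Maybe; just; nothing)
open import Data.Product using (Σ; _×_; _,_; ∃-syntax)
open import Function.Bundles using (_⇔_)
open import Relation.Nullary using (¬_)

Contains : ∀ {n k} → (Fin n → ℕ) → (Fin k → ℕ) → Set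
Contains {n} {k} X π =
  Σ (Fin k → Fin n) λ f → ((∀ i j → i Fin.< j → f i Fin.< f j) ×
          (∀ i j → (X (f i) < X (f j)) ⇔ (π i < π j)))

Avoids : ∀ {n k} → (Fin n → ℕ) → (Fin k → ℕ) → Set
Avoids X π = ¬ Contains X π

decPattern : (k : ℕ) → Fin k → ℕ
decPattern k i = k ∸ toℕ i

incPattern : (k : ℕ) → Fin k → ℕ
incPattern k i = suc (toℕ i)

-- X ∈ S_n viewed as the sequence x_1,...,x_n with values in {1,...,n}:
-- x_{t+1} = 1 + toℕ (X t).
seqOf : ∀ {n} → Permutation′ n → Fin n → ℕ
seqOf X t = suc (toℕ (X ⟨$⟩ʳ t))

data Tree : Set where
  leaf : Tree
  node : Tree → ℕ → Tree → Tree

keys : Tree → List ℕ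
keys leaf         = []
keys (node l x r) = keys l ++ (x ∷ keys r)

data IsBST : Tree → Set where
  leaf : IsBST leaf
  node : ∀ {l x r} → All (_< x) (keys l) → All (x <_) (keys r) →
         IsBST l → IsBST r → IsBST (node l x r)

IsBSTOn : ℕ → Tree → Set
IsBSTOn n T = IsBST T × (∀ x → (x ∈ keys T) ⇔ ((1 ≤ x) × (x ≤ n)))

height : Tree → ℕ
height leaf         = 0
height (node l _ r) = suc (height l ⊔ height r)

-- Geometric view: points (key, time)

Point : Set
Point = ℕ × ℤ

-- For each key x at depth dx (root depth 1), the points (x, s) for
-- s = 1-d, ..., 1-dx, where d = height of the whole tree.
treePointsAt : ℕ → ℕ → Tree → List Point
treePointsAt d dx leaf = []
treePointsAt d dx (node l x r) =
  treePointsAt d (suc dx) l ++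
  applyUpTo (λ j → x , ((+ 1) ℤ.- (+ d)) ℤ.+ (+ j)) (suc (d ∸ dx)) ++
  treePointsAt d (suc dx) r

treePoints : Tree → List Point
treePoints T = treePointsAt (height T) 1 T

_==ℕ_ : ℕ → ℕ → Bool
a ==ℕ b = (a ℕ.≤ᵇ b) ∧ (b ℕ.≤ᵇ a)

_==ℤ_ : ℤ → ℤ → Bool
a ==ℤ b = (a ℤ.≤ᵇ b) ∧ (b ℤ.≤ᵇ a)

maxMaybe : ℤ → Maybe ℤ → Maybe ℤ
maxMaybe s nothing  = just s
maxMaybe s (just u) = just (s ℤ.⊔ u)

latest : List Point → ℕ → Maybe ℤ
latest []             b = nothing
latest ((c , s) ∷ P)  b with c ==ℕ b
... | true  = maxMaybe s (latest P b)
... | false = latest P b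

inRect : Point → Point → Point → Bool
inRect (a , t) (b , s) (c , u) =
  ((a ℕ.⊓ b) ℕ.≤ᵇ c) ∧ (c ℕ.≤ᵇ (a ℕ.⊔ b)) ∧
  ((t ℤ.⊓ s) ℤ.≤ᵇ u) ∧ (u ℤ.≤ᵇ (t ℤ.⊔ s))

samePoint : Point → Point → Bool
samePoint (a , t) (b , s) = (a ==ℕ b) ∧ (t ==ℤ s)

allB : {A : Set} → (A → Bool) → List A → Bool
allB p []       = true
allB p (x ∷ xs) = p x ∧ allB p xs

emptyRect : List Point → Point → Point → Bool
emptyRect P p q = allB (λ r → not (inRect p q r) ∨ samePoint r q) P

-- the keys b ≠ a (b ∈ [n]) touched at time t when accessing a,
-- given the set P = T ∪ {output points at times < t}
touched : ℕ → List Point → ℕ → ℤ → List Point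
touched n P a t = foldr step [] (applyUpTo suc n)
  where
  step : ℕ → List Point → List Point
  step b acc with b ==ℕ a | latest P b
  ... | true  | _        = acc
  ... | false | nothing  = acc
  ... | false | just τb  =
    if emptyRect P (a , t) (b , τb) then (b , t) ∷ acc else acc

greedyFrom : ℕ → List Point → ℕ → List ℕ → List Point
greedyFrom n P t []       = []
greedyFrom n P t (a ∷ as) =
  let new = (a , + t) ∷ touched n P a (+ t)
  in new ++ greedyFrom n (new ++ P) (suc t) as

greedy : ∀ {n} → Tree → Permutation′ n → List Point
greedy {n} T X = greedyFrom n (treePoints T) 1 (map (seqOf X) (allFin n))

greedyCost : ∀ {n} → Tree → Permutation′ n → ℕ
greedyCost T X = length (greedy T X)

{-# OPTIONS --safe #-}

-- Let X avoid (k, …, 1). Suppose Greedy touches points p₀, …, p_k that increase in key and in time,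
-- and that their bounding box contains no access. Put q₀ = p₀ and let qᵢ be the first touch of the
-- column of pᵢ after qᵢ₋₁. The access causing qᵢ cannot come from the left, where the rectangle would
-- contain qᵢ₋₁, so it lies right of the box; it also lies left of the access causing qᵢ₋₁, whose point
-- would otherwise be in the rectangle. This gives k decreasing accesses, a contradiction. So every
-- such box contains an access, and k boxes in decreasing position would again give a decreasing
-- sequence of length k. Hence the touch matrix avoids a permutation of size m = k(k+1), in particular
-- the m × m all-ones matrix as an interval minor. By Fox's refinement of the Marcus–Tardos argument
-- such an n × n matrix has at most n·2^O(m) ones. The other case is the mirror image.
module Submission where

open import Defs
open import Data.Bool using (Bool; true; false; _∧_; _∨_; not; if_then_else_; T)
open import Data.Bool.Properties using (T?; T-∧)
open import Data.Fin as Fin using (Fin; toℕ; fromℕ<)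
import Data.Fin.Properties as Fin
open import Data.Fin.Permutation using (Permutation′)
open import Data.List using (List; []; _∷_; _++_; map; length; allFin; applyUpTo; foldr; filterᵇ; tabulate)
open import Data.List.Membership.Propositional using (_∈_)
open import Data.List.Membership.Propositional.Properties
  using (∈-++⁻; ∈-++⁺ˡ; ∈-++⁺ʳ; ∈-map⁻; ∈-map⁺; ∈-filter⁻; ∈-filter⁺; ∈-applyUpTo⁻; ∈-applyUpTo⁺)
open import Data.List.Properties using (length-++; length-map; map-tabulate)
open import Data.List.Relation.Unary.Any using (here; there)
open import Data.Maybe using (just; nothing)
open import Data.Nat
open import Data.Nat.Properties
open import Data.Nat.Tactic.RingSolver using (solve-∀)
open import Data.Product using (Σ; ∃-syntax; _×_; _,_; proj₁; proj₂)
open import Data.Product.Properties using (≡-dec)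
open import Data.Sum using (_⊎_; inj₁; inj₂)
open import Data.Unit using (tt)
open import Function.Base using (_∘_; flip; id)
open import Function.Bundles using (Equivalence; mk⇔)
open import Relation.Binary.Definitions using (tri<; tri≈; tri>)
open import Relation.Binary.PropositionalEquality
open import Relation.Nullary using (¬_; yes; no; contradiction)
open import Relation.Nullary.Decidable using (isYes; toWitness; fromWitness; _×-dec_)

-- Finite sums

∑ : ℕ → (ℕ → ℕ) → ℕ
∑ zero    f = 0
∑ (suc n) f = ∑ n f + f n

ι : Bool → ℕ
ι true  = 1
ι false = 0

∑-mono : ∀ n {f g : ℕ → ℕ} → (∀ i → f i ≤ g i) → ∑ n f ≤ ∑ n g
∑-mono zero    h = z≤n
∑-mono (suc n) h = +-mono-≤ (∑-mono n h) (h n)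

∑-mono-< : ∀ n {f g : ℕ → ℕ} → (∀ i → i < n → f i ≤ g i) → ∑ n f ≤ ∑ n g
∑-mono-< zero    h = z≤n
∑-mono-< (suc n) h = +-mono-≤ (∑-mono-< n (λ i i<n → h i (m≤n⇒m≤1+n i<n))) (h n ≤-refl)

∑-cong : ∀ n {f g : ℕ → ℕ} → (∀ i → f i ≡ g i) → ∑ n f ≡ ∑ n g
∑-cong zero    h = refl
∑-cong (suc n) h = cong₂ _+_ (∑-cong n h) (h n)

∑-≤-const : ∀ n c {f : ℕ → ℕ} → (∀ i → f i ≤ c) → ∑ n f ≤ n * c
∑-≤-const zero    c h = z≤n
∑-≤-const (suc n) c h =
  ≤-trans (+-mono-≤ (∑-≤-const n c h) (h n)) (≤-reflexive (+-comm (n * c) c))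

∑-+ : ∀ n (f g : ℕ → ℕ) → ∑ n (λ i → f i + g i) ≡ ∑ n f + ∑ n g
∑-+ zero    f g = refl
∑-+ (suc n) f g = trans (cong (_+ (f n + g n)) (∑-+ n f g)) (lemma (∑ n f) (∑ n g) (f n) (g n))
  where
  lemma : ∀ a b c d → a + b + (c + d) ≡ a + c + (b + d)
  lemma = solve-∀

∑-*ˡ : ∀ n c (f : ℕ → ℕ) → ∑ n (λ i → c * f i) ≡ c * ∑ n f
∑-*ˡ zero    c f = sym (*-zeroʳ c)
∑-*ˡ (suc n) c f = trans (cong (_+ c * f n) (∑-*ˡ n c f)) (sym (*-distribˡ-+ c _ _))

∑-*ʳ : ∀ n c (f : ℕ → ℕ) → ∑ n (λ i → f i * c) ≡ ∑ n f * c
∑-*ʳ zero    c f = refl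
∑-*ʳ (suc n) c f = trans (cong (_+ f n * c) (∑-*ʳ n c f)) (sym (*-distribʳ-+ c (∑ n f) _))

∑-zero : ∀ n → ∑ n (λ _ → 0) ≡ 0
∑-zero zero    = refl
∑-zero (suc n) = trans (+-identityʳ _) (∑-zero n)

∑-swap : ∀ m n (f : ℕ → ℕ → ℕ) →
  ∑ m (λ i → ∑ n (λ j → f i j)) ≡ ∑ n (λ j → ∑ m (λ i → f i j))
∑-swap zero    n f = sym (∑-zero n)
∑-swap (suc m) n f = trans (cong (_+ ∑ n (f m)) (∑-swap m n f)) (sym (∑-+ n _ (f m)))

∑-split : ∀ m n (f : ℕ → ℕ) → ∑ (m + n) f ≡ ∑ m f + ∑ n (λ i → f (m + i))
∑-split m zero    f = trans (cong (λ k → ∑ k f) (+-identityʳ m)) (sym (+-identityʳ _))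
∑-split m (suc n) f rewrite +-suc m n | ∑-split m n f = +-assoc (∑ m f) _ _

∑-blocks : ∀ a b (f : ℕ → ℕ) → ∑ (a * b) f ≡ ∑ a (λ q → ∑ b (λ r → f (q * b + r)))
∑-blocks zero    b f = refl
∑-blocks (suc a) b f = begin
  ∑ (b + a * b) f                          ≡⟨ cong (λ k → ∑ k f) (+-comm b (a * b)) ⟩
  ∑ (a * b + b) f                          ≡⟨ ∑-split (a * b) b f ⟩
  ∑ (a * b) f + ∑ b (λ r → f (a * b + r))  ≡⟨ cong (_+ ∑ b (λ r → f (a * b + r))) (∑-blocks a b f) ⟩
  ∑ (suc a) (λ q → ∑ b (λ r → f (q * b + r))) ∎
  where open ≡-Reasoning

∑-widen : ∀ {m n} (f : ℕ → ℕ) → m ≤ n → ∑ m f ≤ ∑ n f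
∑-widen {m} f m≤n with m≤n⇒∃[o]m+o≡n m≤n
... | k , refl = ≤-trans (m≤m+n _ _) (≤-reflexive (sym (∑-split m k f)))

∑-term : ∀ n (f : ℕ → ℕ) {i} → i < n → f i ≤ ∑ n f
∑-term n f {i} i<n = ≤-trans (m≤n+m (f i) (∑ i f)) (∑-widen f i<n)

∑-head : ∀ n (f : ℕ → ℕ) → ∑ (suc n) f ≡ f 0 + ∑ n (f ∘ suc)
∑-head n f = ∑-split 1 n f

∑-reverse : ∀ n (f : ℕ → ℕ) → ∑ n (f ∘ suc) ≡ ∑ n (λ i → f (n ∸ i))
∑-reverse zero    f = refl
∑-reverse (suc n) f = begin
  ∑ n (f ∘ suc) + f (suc n)            ≡⟨ +-comm _ (f (suc n)) ⟩
  f (suc n) + ∑ n (f ∘ suc)            ≡⟨ cong (f (suc n) +_) (∑-reverse n f) ⟩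
  f (suc n) + ∑ n (λ i → f (n ∸ i))    ≡⟨ ∑-head n (λ i → f (suc n ∸ i)) ⟨
  ∑ (suc n) (λ i → f (suc n ∸ i))      ∎
  where open ≡-Reasoning

∑-witness : ∀ n (f : ℕ → ℕ) → 1 ≤ ∑ n f → ∃[ i ] (i < n × 1 ≤ f i)
∑-witness (suc n) f h with f n in eq
... | suc _ = n , ≤-refl , subst (1 ≤_) (sym eq) (s≤s z≤n)
... | zero with ∑-witness n f (subst (1 ≤_) (+-identityʳ _) h)
...   | i , i<n , p = i , m≤n⇒m≤1+n i<n , p

ι≤1 : ∀ b → ι b ≤ 1
ι≤1 true  = ≤-refl
ι≤1 false = z≤n

T⇒1≤ι : ∀ {b} → T b → 1 ≤ ι b
T⇒1≤ι {true} _ = ≤-refl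

1≤ι⇒T : ∀ {b} → 1 ≤ ι b → T b
1≤ι⇒T {true} _ = tt

ι≤ : ∀ {b x} → (T b → 1 ≤ x) → ι b ≤ x
ι≤ {true}  h = h tt
ι≤ {false} h = z≤n

m≤m*ι : ∀ m {b} → T b → m ≤ m * ι b
m≤m*ι m {true} _ = ≤-reflexive (sym (*-identityʳ m))

m<2^m : ∀ m → m < 2 ^ m
m<2^m zero    = s≤s z≤n
m<2^m (suc m) = ≤-trans (+-mono-≤ (m^n>0 2 m) (m<2^m m)) (+-monoʳ-≤ (2 ^ m) (m≤m+n _ 0))

some : ℕ → (ℕ → Bool) → Bool
some n p = 1 ≤ᵇ ∑ n (ι ∘ p)

some⁺ : ∀ n p {i} → i < n → T (p i) → T (some n p)
some⁺ n p i<n h = ≤⇒≤ᵇ (≤-trans (T⇒1≤ι h) (∑-term n (ι ∘ p) i<n))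

1≤∑ι⇒∃ : ∀ n p → 1 ≤ ∑ n (ι ∘ p) → ∃[ i ] (i < n × T (p i))
1≤∑ι⇒∃ n p h with ∑-witness n (ι ∘ p) h
... | i , i<n , q = i , i<n , 1≤ι⇒T q

some⁻ : ∀ n p → T (some n p) → ∃[ i ] (i < n × T (p i))
some⁻ n p h = 1≤∑ι⇒∃ n p (≤ᵇ⇒≤ 1 _ h)

-- Interval minors of 0/1 matrices

Matrix : Set
Matrix = ℕ → ℕ → Bool

Monotone : (ℕ → ℕ) → Set
Monotone ρ = ∀ i → ρ i ≤ ρ (suc i)

monotone⇒≤ : ∀ {ρ} → Monotone ρ → ∀ {i j} → i ≤ j → ρ i ≤ ρ j
monotone⇒≤ {ρ} mono {i} {j} i≤j with m≤n⇒∃[o]m+o≡n i≤j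
... | d , refl = go d
  where
  go : ∀ d → ρ i ≤ ρ (i + d)
  go zero    = ≤-reflexive (cong ρ (sym (+-identityʳ i)))
  go (suc d) = ≤-trans (go d) (≤-trans (mono (i + d)) (≤-reflexive (cong ρ (sym (+-suc i d)))))

_∈[_,_⟩ : ℕ → ℕ → ℕ → Set
x ∈[ lo , hi ⟩ = lo ≤ x × x < hi

-- ρ and γ cut the rows and the columns into consecutive intervals so that all cells in the
-- first k row intervals and the first l column intervals contain a 1.
record Minor (k l : ℕ) (A : Matrix) : Set where
  field
    ρ γ    : ℕ → ℕ
    ρ-mono : Monotone ρ
    γ-mono : Monotone γ
    cell   : ∀ {i j} → i < k → j < l →
             ∃[ r ] ∃[ c ] (r ∈[ ρ i , ρ (suc i) ⟩ × c ∈[ γ j , γ (suc j) ⟩ × T (A r c))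

transposeMinor : ∀ {k l A} → Minor k l (flip A) → Minor l k A
transposeMinor m = record
  { ρ = γ ; γ = ρ ; ρ-mono = γ-mono ; γ-mono = ρ-mono
  ; cell = λ i<l j<k → let (r , c , r∈ , c∈ , h) = cell j<k i<l in c , r , c∈ , r∈ , h }
  where open Minor m

-- Cut sequences are total, but `l` intervals use only the cuts up to index `l`. The later ones are
-- free, so overwriting them by `h` makes the next interval run from `γ l` to `h`.
snoc : (ℕ → ℕ) → ℕ → ℕ → ℕ → ℕ
snoc γ l h i with i ≤? l
... | yes _ = γ i
... | no  _ = h

snoc-≤ : ∀ γ l h {i} → i ≤ l → snoc γ l h i ≡ γ i
snoc-≤ γ l h {i} i≤l with i ≤? l
... | yes _ = refl
... | no  p = contradiction i≤l p

snoc-> : ∀ γ l h {i} → l < i → snoc γ l h i ≡ h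
snoc-> γ l h {i} l<i with i ≤? l
... | yes p = contradiction l<i (≤⇒≯ p)
... | no  _ = refl

snoc-mono : ∀ {γ} l h → Monotone γ → γ l ≤ h → Monotone (snoc γ l h)
snoc-mono {γ} l h mono γl≤h i with i ≤? l | suc i ≤? l
... | yes _ | yes _ = mono i
... | yes p | no  _ = ≤-trans (monotone⇒≤ mono p) γl≤h
... | no  p | yes q = contradiction (≤-trans (n≤1+n i) q) p
... | no  _ | no  _ = ≤-refl

snoc-within : ∀ {γ lo hi} l h → (∀ i → lo ≤ γ i × γ i ≤ hi) → lo ≤ h → h ≤ hi →
  ∀ i → lo ≤ snoc γ l h i × snoc γ l h i ≤ hi
snoc-within l h w lo≤h h≤hi i with i ≤? l
... | yes _ = w i
... | no  _ = lo≤h , h≤hi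

snoc-∈ : ∀ γ l h {i x} → i < l → x ∈[ γ i , γ (suc i) ⟩ →
  x ∈[ snoc γ l h i , snoc γ l h (suc i) ⟩
snoc-∈ γ l h i<l x∈ rewrite snoc-≤ γ l h (<⇒≤ i<l) | snoc-≤ γ l h i<l = x∈

snoc-∈-last : ∀ γ l h {x} → γ l ≤ x → x < h → x ∈[ snoc γ l h l , snoc γ l h (suc l) ⟩
snoc-∈-last γ l h p q rewrite snoc-≤ γ l h (≤-refl {l}) | snoc-> γ l h (n<1+n l) = p , q

-- As Minor, but the 1s of a row interval lie in a single row from Q.
record RowMinor (k l : ℕ) (Q : ℕ → Bool) (A : Matrix) (lo hi : ℕ) : Set where
  field
    ρ γ    : ℕ → ℕ
    ρ-mono : Monotone ρ
    γ-mono : Monotone γ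
    within : ∀ j → lo ≤ γ j × γ j ≤ hi
    cells  : ∀ {i} → i < k → ∃[ r ] (r ∈[ ρ i , ρ (suc i) ⟩ × T (Q r) ×
             (∀ {j} → j < l → ∃[ c ] (c ∈[ γ j , γ (suc j) ⟩ × T (A r c))))

rowMinor-⊆ : ∀ {k l Q Q′ A lo lo′ hi hi′} → (∀ q → T (Q′ q) → T (Q q)) → lo ≤ lo′ → hi′ ≤ hi →
  RowMinor k l Q′ A lo′ hi′ → RowMinor k l Q A lo hi
rowMinor-⊆ Q′⊆Q lo≤ ≤hi m = record
  { ρ = ρ ; γ = γ ; ρ-mono = ρ-mono ; γ-mono = γ-mono
  ; within = λ j → ≤-trans lo≤ (proj₁ (within j)) , ≤-trans (proj₂ (within j)) ≤hi
  ; cells = λ i<k → let (r , r∈ , q , h) = cells i<k in r , r∈ , Q′⊆Q r q , h }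
  where open RowMinor m

-- The new last interval starts at `γ l`, possibly left of `mid`, and ends at `hi`; it still covers
-- the columns from `mid` on, where every row of `Q` has a 1.
rowMinor-snoc : ∀ {k l Q A lo mid hi} → mid ≤ hi →
  (∀ q → T (Q q) → ∃[ c ] (c ∈[ mid , hi ⟩ × T (A q c))) →
  RowMinor k l Q A lo mid → RowMinor k (suc l) Q A lo hi
rowMinor-snoc {k} {l} {Q} {A} {lo} {mid} {hi} mid≤hi last m = record
  { ρ = ρ ; γ = snoc γ l hi ; ρ-mono = ρ-mono
  ; γ-mono = snoc-mono l hi γ-mono (≤-trans γl≤mid mid≤hi)
  ; within = snoc-within l hi
               (λ j → proj₁ (within j) , ≤-trans (proj₂ (within j)) mid≤hi)
               (≤-trans (proj₁ (within l)) (≤-trans γl≤mid mid≤hi)) ≤-refl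
  ; cells = λ i<k → let (r , r∈ , q , h) = cells i<k in r , r∈ , q , λ j<1+l → extend r q h (m<1+n⇒m<n∨m≡n j<1+l) }
  where
  open RowMinor m
  γl≤mid : γ l ≤ mid
  γl≤mid = proj₂ (within l)
  extend : ∀ r → T (Q r) → (∀ {j} → j < l → ∃[ c ] (c ∈[ γ j , γ (suc j) ⟩ × T (A r c))) →
    ∀ {j} → j < l ⊎ j ≡ l → ∃[ c ] (c ∈[ snoc γ l hi j , snoc γ l hi (suc j) ⟩ × T (A r c))
  extend r q h (inj₁ j<l) = let (c , c∈ , x) = h j<l in c , snoc-∈ γ l hi j<l c∈ , x
  extend r q h (inj₂ refl) = let (c , (mid≤c , c<hi) , x) = last r q in
    c , snoc-∈-last γ l hi (≤-trans γl≤mid mid≤c) c<hi , x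

-- The new first interval starts at `lo` and ends at the old first cut, which is at least `mid`.
rowMinor-cons : ∀ {k l Q A lo mid hi} → lo ≤ mid → mid ≤ hi →
  (∀ q → T (Q q) → ∃[ c ] (c ∈[ lo , mid ⟩ × T (A q c))) →
  RowMinor k l Q A mid hi → RowMinor k (suc l) Q A lo hi
rowMinor-cons {k} {l} {Q} {A} {lo} {mid} {hi} lo≤mid mid≤hi first m = record
  { ρ = ρ ; γ = cuts ; ρ-mono = ρ-mono ; γ-mono = cuts-mono ; within = cuts-within
  ; cells = λ i<k → let (r , r∈ , q , h) = cells i<k in r , r∈ , q , extend r q h }
  where
  open RowMinor m
  cuts : ℕ → ℕ
  cuts zero    = lo
  cuts (suc j) = γ j
  cuts-mono : Monotone cuts
  cuts-mono zero    = ≤-trans lo≤mid (proj₁ (within 0))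
  cuts-mono (suc j) = γ-mono j
  cuts-within : ∀ j → lo ≤ cuts j × cuts j ≤ hi
  cuts-within zero    = ≤-refl , ≤-trans lo≤mid mid≤hi
  cuts-within (suc j) = ≤-trans lo≤mid (proj₁ (within j)) , proj₂ (within j)
  extend : ∀ r → T (Q r) → (∀ {j} → j < l → ∃[ c ] (c ∈[ γ j , γ (suc j) ⟩ × T (A r c))) →
    ∀ {j} → j < suc l → ∃[ c ] (c ∈[ cuts j , cuts (suc j) ⟩ × T (A r c))
  extend r q h {zero}  _ = let (c , (lo≤c , c<mid) , x) = first r q in
    c , (lo≤c , ≤-trans c<mid (proj₁ (within 0))) , x
  extend r q h {suc j} j<l = h (s≤s⁻¹ j<l)

-- A cut is placed right behind each row of `Q`. The bound `ρ i ≤ N` lets the induction append the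
-- cut `suc N` monotonically.
separateRows : ∀ N (Q : ℕ → Bool) → ∃[ ρ ] (Monotone ρ × (∀ i → ρ i ≤ N) ×
  (∀ {i} → i < ∑ N (ι ∘ Q) → ∃[ r ] (r ∈[ ρ i , ρ (suc i) ⟩ × T (Q r))))
separateRows zero Q = (λ _ → 0) , (λ _ → z≤n) , (λ _ → z≤n) , λ ()
separateRows (suc N) Q with separateRows N Q | Q N in eq
... | ρ , mono , ρ≤N , found | false =
  ρ , mono , (λ i → m≤n⇒m≤1+n (ρ≤N i)) , λ {i} i< → found (subst (i <_) (+-identityʳ _) i<)
... | ρ , mono , ρ≤N , found | true =
  snoc ρ l (suc N) , snoc-mono l (suc N) mono (m≤n⇒m≤1+n (ρ≤N l)) ,
  (λ i → proj₂ (snoc-within l (suc N) (λ i → z≤n , m≤n⇒m≤1+n (ρ≤N i)) z≤n ≤-refl i)) ,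
  λ {i} i< → extend (m<1+n⇒m<n∨m≡n (subst (i <_) (+-comm l 1) i<))
  where
  l : ℕ
  l = ∑ N (ι ∘ Q)
  extend : ∀ {i} → i < l ⊎ i ≡ l →
    ∃[ r ] (r ∈[ snoc ρ l (suc N) i , snoc ρ l (suc N) (suc i) ⟩ × T (Q r))
  extend (inj₁ i<l) = let (r , r∈ , q) = found i<l in r , snoc-∈ ρ l (suc N) i<l r∈ , q
  extend (inj₂ refl) = N , snoc-∈-last ρ l (suc N) (ρ≤N l) ≤-refl , subst T (sym eq) tt

-- Halve the columns: a row with 2^(l+1) ones has them all in one half, or has one in each half
-- and 2^l in one of them; in the latter case a minor in that half gains a column interval.
rowMinor-bound : ∀ τ l k lo (A : Matrix) (Q : ℕ → Bool) N →
  (∀ q → T (Q q) → 2 ^ l ≤ ∑ (2 ^ τ) (λ j → ι (A q (lo + j)))) →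
  ¬ RowMinor k l Q A lo (lo + 2 ^ τ) → ∑ N (ι ∘ Q) ≤ k * 4 ^ τ
-- Without column intervals, any `k` rows of `Q` already form a minor.
rowMinor-bound τ zero k lo A Q N _ avoids with k ≤? ∑ N (ι ∘ Q) | separateRows N Q
... | no k≰ | _ = ≤-trans (<⇒≤ (≰⇒> k≰)) (m≤m*n k (4 ^ τ) {{m^n≢0 4 τ}})
... | yes k≤ | ρ , mono , _ , found = contradiction (record
  { ρ = ρ ; γ = λ _ → lo ; ρ-mono = mono ; γ-mono = λ _ → ≤-refl
  ; within = λ _ → ≤-refl , m≤m+n lo _
  ; cells = λ i<k → let (r , r∈ , q) = found (≤-trans i<k k≤) in r , r∈ , q , λ () }) avoids
-- A single column cannot hold `2 ^ suc l` ones, so no row qualifies.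
rowMinor-bound zero (suc l) k lo A Q N dense _ =
  ≤-trans (∑-≤-const N 0 (λ q → ι≤ (λ Qq → contradiction (dense q Qq) (<⇒≱ (few q)))))
          (≤-trans (≤-reflexive (*-zeroʳ N)) z≤n)
  where
  few : ∀ q → ι (A q (lo + 0)) < 2 ^ suc l
  few q = ≤-trans (s≤s (ι≤1 _)) (*-monoʳ-≤ 2 (m^n>0 2 l))
rowMinor-bound (suc τ) (suc l) k lo A Q N dense avoids = begin
  ∑ N (ι ∘ Q)
    ≤⟨ ∑-mono N (λ q → ι≤ (cases q)) ⟩
  ∑ N (λ q → ι (Q₁ q) + ι (Q₂ q) + (ι (Q₃ q) + ι (Q₄ q)))
    ≡⟨ trans (∑-+ N _ _) (cong₂ _+_ (∑-+ N _ _) (∑-+ N _ _)) ⟩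
  ∑ N (ι ∘ Q₁) + ∑ N (ι ∘ Q₂) + (∑ N (ι ∘ Q₃) + ∑ N (ι ∘ Q₄))
    ≤⟨ +-mono-≤ (+-mono-≤ bound₁ bound₂) (+-mono-≤ bound₃ bound₄) ⟩
  k * 4 ^ τ + k * 4 ^ τ + (k * 4 ^ τ + k * 4 ^ τ)
    ≡⟨ quadruple k (4 ^ τ) ⟩
  k * 4 ^ suc τ ∎
  where
  open ≤-Reasoning
  quadruple : ∀ k x → k * x + k * x + (k * x + k * x) ≡ k * (4 * x)
  quadruple = solve-∀

  w mid hi : ℕ
  w   = 2 ^ τ
  mid = lo + w
  hi  = lo + 2 ^ suc τ

  hi≡mid+w : hi ≡ mid + w
  hi≡mid+w = lemma lo w
    where
    lemma : ∀ a b → a + 2 * b ≡ a + b + b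
    lemma = solve-∀

  mid≤hi : mid ≤ hi
  mid≤hi = ≤-trans (m≤m+n mid w) (≤-reflexive (sym hi≡mid+w))

  L R : ℕ → ℕ
  L q = ∑ w (λ j → ι (A q (lo + j)))
  R q = ∑ w (λ j → ι (A q (mid + j)))

  dense′ : ∀ q → T (Q q) → 2 ^ suc l ≤ L q + R q
  dense′ q Qq = begin
    2 ^ suc l
      ≤⟨ dense q Qq ⟩
    ∑ (2 * w) (λ j → ι (A q (lo + j)))
      ≡⟨ cong (λ n → ∑ n (λ j → ι (A q (lo + j)))) (cong (w +_) (+-identityʳ w)) ⟩
    ∑ (w + w) (λ j → ι (A q (lo + j)))
      ≡⟨ ∑-split w w _ ⟩
    L q + ∑ w (λ j → ι (A q (lo + (w + j))))
      ≡⟨ cong (L q +_) (∑-cong w (λ j → cong (ι ∘ A q) (sym (+-assoc lo w j)))) ⟩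
    L q + R q ∎

  inLeft : ∀ q → 1 ≤ L q → ∃[ c ] (c ∈[ lo , mid ⟩ × T (A q c))
  inLeft q h = let (j , j<w , x) = 1≤∑ι⇒∃ w (λ j → A q (lo + j)) h in
    lo + j , (m≤m+n lo j , +-monoʳ-< lo j<w) , x

  inRight : ∀ q → 1 ≤ R q → ∃[ c ] (c ∈[ mid , hi ⟩ × T (A q c))
  inRight q h = let (j , j<w , x) = 1≤∑ι⇒∃ w (λ j → A q (mid + j)) h in
    mid + j , (m≤m+n mid j , ≤-trans (+-monoʳ-< mid j<w) (≤-reflexive (sym hi≡mid+w))) , x

  -- The four classes cover `Q`, possibly with overlaps. Each is bounded recursively over half the
  -- width, which is the origin of the base 4.
  Q₁ Q₂ Q₃ Q₄ : ℕ → Bool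
  Q₁ q = Q q ∧ (2 ^ suc l ≤ᵇ L q)
  Q₂ q = Q q ∧ (2 ^ suc l ≤ᵇ R q)
  Q₃ q = Q q ∧ ((2 ^ l ≤ᵇ L q) ∧ (1 ≤ᵇ R q))
  Q₄ q = Q q ∧ ((2 ^ l ≤ᵇ R q) ∧ (1 ≤ᵇ L q))

  ∧⁺ : ∀ {a b} → T a → T b → T (a ∧ b)
  ∧⁺ p q = Equivalence.from T-∧ (p , q)
  ∧⁻ : ∀ {a b} → T (a ∧ b) → T a × T b
  ∧⁻ = Equivalence.to T-∧

  cases : ∀ q → T (Q q) → 1 ≤ ι (Q₁ q) + ι (Q₂ q) + (ι (Q₃ q) + ι (Q₄ q))
  cases q Qq with 1 ≤? L q | 1 ≤? R q | 2 ^ l ≤? L q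
  ... | no L≱1 | _ | _ =
    ≤-trans (≤-trans (T⇒1≤ι (∧⁺ Qq (≤⇒≤ᵇ
      (subst (λ x → 2 ^ suc l ≤ x + R q) (n<1⇒n≡0 (≰⇒> L≱1)) (dense′ q Qq)))))
      (m≤n+m _ (ι (Q₁ q)))) (m≤m+n _ _)
  ... | yes _ | no R≱1 | _ =
    ≤-trans (≤-trans (T⇒1≤ι (∧⁺ Qq (≤⇒≤ᵇ (≤-trans (dense′ q Qq) (≤-reflexive
      (trans (cong (L q +_) (n<1⇒n≡0 (≰⇒> R≱1))) (+-identityʳ (L q))))))))
      (m≤m+n _ (ι (Q₂ q)))) (m≤m+n _ _)
  ... | yes _ | yes R≥1 | yes L≥ =
    ≤-trans (≤-trans (T⇒1≤ι (∧⁺ Qq (∧⁺ (≤⇒≤ᵇ L≥) (≤⇒≤ᵇ R≥1)))) (m≤m+n _ (ι (Q₄ q)))) (m≤n+m _ (ι (Q₁ q) + ι (Q₂ q)))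
  ... | yes L≥1 | yes _ | no L≱ =
    ≤-trans (≤-trans (T⇒1≤ι (∧⁺ Qq (∧⁺ (≤⇒≤ᵇ R≥) (≤⇒≤ᵇ L≥1)))) (m≤n+m _ (ι (Q₃ q)))) (m≤n+m _ (ι (Q₁ q) + ι (Q₂ q)))
    where
    -- With fewer than half of the `2 ^ suc l` ones on the left, at least half are on the right.
    R≥ : 2 ^ l ≤ R q
    R≥ = +-cancelˡ-≤ (2 ^ l) _ _ (≤-trans (≤-reflexive (cong (2 ^ l +_) (sym (+-identityʳ (2 ^ l)))))
           (≤-trans (dense′ q Qq) (+-monoˡ-≤ (R q) (<⇒≤ (≰⇒> L≱)))))

  bound₁ : ∑ N (ι ∘ Q₁) ≤ k * 4 ^ τ
  bound₁ = rowMinor-bound τ (suc l) k lo A Q₁ N (λ q h → ≤ᵇ⇒≤ _ _ (proj₂ (∧⁻ {Q q} h)))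
    (avoids ∘ rowMinor-⊆ (λ q → proj₁ ∘ ∧⁻) ≤-refl mid≤hi)

  bound₂ : ∑ N (ι ∘ Q₂) ≤ k * 4 ^ τ
  bound₂ = rowMinor-bound τ (suc l) k mid A Q₂ N (λ q h → ≤ᵇ⇒≤ _ _ (proj₂ (∧⁻ {Q q} h)))
    (avoids ∘ rowMinor-⊆ (λ q → proj₁ ∘ ∧⁻) (m≤m+n lo w) (≤-reflexive (sym hi≡mid+w)))

  bound₃ : ∑ N (ι ∘ Q₃) ≤ k * 4 ^ τ
  bound₃ = rowMinor-bound τ l k lo A Q₃ N
    (λ q h → ≤ᵇ⇒≤ _ _ (proj₁ (∧⁻ {2 ^ l ≤ᵇ L q} (proj₂ (∧⁻ {Q q} h)))))
    (avoids ∘ rowMinor-⊆ (λ q → proj₁ ∘ ∧⁻) ≤-refl ≤-refl ∘ rowMinor-snoc mid≤hi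
      (λ q h → inRight q (≤ᵇ⇒≤ _ _ (proj₂ (∧⁻ {2 ^ l ≤ᵇ L q} (proj₂ (∧⁻ {Q q} h)))))))

  bound₄ : ∑ N (ι ∘ Q₄) ≤ k * 4 ^ τ
  bound₄ = rowMinor-bound τ l k mid A Q₄ N
    (λ q h → ≤ᵇ⇒≤ _ _ (proj₁ (∧⁻ {2 ^ l ≤ᵇ R q} (proj₂ (∧⁻ {Q q} h)))))
    (avoids ∘ rowMinor-⊆ (λ q → proj₁ ∘ ∧⁻) ≤-refl (≤-reflexive (sym hi≡mid+w)) ∘
      rowMinor-cons (m≤m+n lo w) (m≤m+n mid w)
      (λ q h → inLeft q (≤ᵇ⇒≤ _ _ (proj₂ (∧⁻ {2 ^ l ≤ᵇ R q} (proj₂ (∧⁻ {Q q} h)))))))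

-- Contracting a matrix along blocks of side `t`

module Blocks (t : ℕ) where

  inBlock : ∀ {q q′ r} → q < q′ → r < t → q * t + r < q′ * t
  inBlock {q} {q′} {r} q<q′ r<t = begin-strict
    q * t + r  <⟨ +-monoʳ-< (q * t) r<t ⟩
    q * t + t  ≡⟨ +-comm (q * t) t ⟩
    suc q * t  ≤⟨ *-monoˡ-≤ t q<q′ ⟩
    q′ * t     ∎
    where open ≤-Reasoning

  ∈-block : ∀ {q lo hi r} → q ∈[ lo , hi ⟩ → r < t → (q * t + r) ∈[ lo * t , hi * t ⟩
  ∈-block (lo≤q , q<hi) r<t = ≤-trans (*-monoˡ-≤ t lo≤q) (m≤m+n _ _) , inBlock q<hi r<t

  contractRows contract : Matrix → Matrix
  contractRows A q c = some t (λ r → A (q * t + r) c)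
  contract A q p     = some t (λ c → contractRows A q (p * t + c))

  -- A 1 of a contracted row comes from one of `t` rows, and which one may vary with the column.
  -- Interval minors tolerate this, since those rows all lie in the same row interval; a submatrix
  -- would not.
  contractRows-minor : ∀ {k l Q A lo hi} → RowMinor k l Q (contractRows A) lo hi → Minor k l A
  contractRows-minor {A = A} m = record
    { ρ = λ i → ρ i * t ; γ = γ ; ρ-mono = λ i → *-monoˡ-≤ t (ρ-mono i) ; γ-mono = γ-mono
    ; cell = λ i<k j<l →
        let (q , q∈ , _ , h) = cells i<k
            (c , c∈ , x)     = h j<l
            (r , r<t , y)    = some⁻ t (λ r → A (q * t + r) c) x
        in q * t + r , c , ∈-block q∈ r<t , c∈ , y }
    where open RowMinor m

  -- Scaling the cuts by `t` turns intervals of blocks into intervals of rows and columns, so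
  -- avoidance is inherited by the contracted matrix.
  contract-minor : ∀ {k l A} → Minor k l (contract A) → Minor k l A
  contract-minor {A = A} m = record
    { ρ = λ i → ρ i * t ; γ = λ j → γ j * t
    ; ρ-mono = λ i → *-monoˡ-≤ t (ρ-mono i) ; γ-mono = λ j → *-monoˡ-≤ t (γ-mono j)
    ; cell = λ i<k j<l →
        let (q , p , q∈ , p∈ , x) = cell i<k j<l
            (c , c<t , y)         = some⁻ t (λ c → contractRows A q (p * t + c)) x
            (r , r<t , z)         = some⁻ t (λ r → A (q * t + r) (p * t + c)) y
        in q * t + r , p * t + c , ∈-block q∈ r<t , ∈-block p∈ c<t , z }
    where open Minor m

  -- The number of nonempty columns of block `(q , p)`. The number of its nonempty rows is
  -- `width (flip A) p q`.
  width : Matrix → ℕ → ℕ → ℕ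
  width A q p = ∑ t (λ c → ι (contractRows A q (p * t + c)))

  wide : ℕ → Matrix → ℕ → ℕ → Bool
  wide s A q p = s ≤ᵇ width A q p

  weight : Matrix → ℕ → ℕ → ℕ
  weight A q p = ∑ t (λ r → ∑ t (λ c → ι (A (q * t + r) (p * t + c))))

  weight≤t² : ∀ A q p → weight A q p ≤ t * t
  weight≤t² A q p = ∑-≤-const t t
    (λ r → ≤-trans (∑-≤-const t 1 (λ c → ι≤1 _)) (≤-reflexive (*-identityʳ t)))

  -- A 1 lies in a nonempty row and in a nonempty column of its block.
  weight≤height*width : ∀ A q p → weight A q p ≤ width (flip A) p q * width A q p
  weight≤height*width A q p = begin
    weight A q p
      ≤⟨ ∑-mono-< t (λ r r<t → ∑-mono-< t (λ c c<t → ι≤ (λ h →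
           *-mono-≤ (T⇒1≤ι (some⁺ t (λ c → A (q * t + r) (p * t + c)) c<t h))
                    (T⇒1≤ι (some⁺ t (λ r → A (q * t + r) (p * t + c)) r<t h))))) ⟩
    ∑ t (λ r → ∑ t (λ c → ι (row r) * ι (col c)))
      ≡⟨ ∑-cong t (λ r → ∑-*ˡ t (ι (row r)) (ι ∘ col)) ⟩
    ∑ t (λ r → ι (row r) * width A q p)
      ≡⟨ ∑-*ʳ t (width A q p) (ι ∘ row) ⟩
    width (flip A) p q * width A q p ∎
    where
    open ≤-Reasoning
    row col : ℕ → Bool
    row r = contractRows (flip A) p (q * t + r)
    col c = contractRows A q (p * t + c)

  -- A wide or tall block is charged its full area. Any other nonempty block has fewer than `s`
  -- nonempty rows and columns, hence at most `s * s` ones, and is charged to its 1 in the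
  -- contracted matrix.
  weight≤ : ∀ s A q p → weight A q p ≤
    t * t * ι (wide s A q p) + t * t * ι (wide s (flip A) p q) + s * s * ι (contract A q p)
  weight≤ s A q p with s ≤? width A q p | s ≤? width (flip A) p q | 1 ≤? weight A q p
  ... | yes s≤ | _ | _ = ≤-trans (weight≤t² A q p)
    (≤-trans (m≤m*ι (t * t) (≤⇒≤ᵇ s≤)) (≤-trans (m≤m+n _ _) (m≤m+n _ _)))
  ... | no _ | yes s≤ | _ = ≤-trans (weight≤t² A q p)
    (≤-trans (m≤m*ι (t * t) (≤⇒≤ᵇ s≤)) (≤-trans (m≤n+m _ (t * t * ι (wide s A q p))) (m≤m+n _ _)))
  ... | no _ | no _ | no w≱1 = ≤-trans (s≤s⁻¹ (≰⇒> w≱1)) z≤n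
  ... | no s≰ | no s≰′ | yes w≥1 = ≤-trans (weight≤height*width A q p)
    (≤-trans (*-mono-≤ (<⇒≤ (≰⇒> s≰′)) (<⇒≤ (≰⇒> s≰)))
    (≤-trans (m≤m*ι (s * s) nonempty)
      (m≤n+m _ (t * t * ι (wide s A q p) + t * t * ι (wide s (flip A) p q)))))
    where
    nonempty : T (contract A q p)
    nonempty =
      let (r , r<t , x) = ∑-witness t _ w≥1
          (c , c<t , y) = 1≤∑ι⇒∃ t (λ c → A (q * t + r) (p * t + c)) x
      in some⁺ t (λ c → contractRows A q (p * t + c)) c<t
           (some⁺ t (λ r → A (q * t + r) (p * t + c)) r<t y)

ones : ℕ → Matrix → ℕ
ones N A = ∑ N (λ r → ∑ N (λ c → ι (A r c)))

ones-blocks : ∀ t N A → ones (N * t) A ≡ ∑ N (λ q → ∑ N (λ p → Blocks.weight t A q p))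
ones-blocks t N A = trans (∑-blocks N t _) (∑-cong N (λ q →
  trans (∑-cong t (λ r → ∑-blocks N t _)) (∑-swap t N _)))

∑∑-linear : ∀ N a b c (f g h : ℕ → ℕ → ℕ) →
  ∑ N (λ i → ∑ N (λ j → a * f i j + b * g i j + c * h i j)) ≡
  a * ∑ N (λ i → ∑ N (f i)) + b * ∑ N (λ i → ∑ N (g i)) + c * ∑ N (λ i → ∑ N (h i))
∑∑-linear N a b c f g h = trans (∑-cong N (λ i → linear (f i) (g i) (h i))) (linear _ _ _)
  where
  linear : ∀ (f g h : ℕ → ℕ) → ∑ N (λ i → a * f i + b * g i + c * h i) ≡ a * ∑ N f + b * ∑ N g + c * ∑ N h
  linear f g h = trans (∑-+ N _ _) (cong₂ _+_
    (trans (∑-+ N _ _) (cong₂ _+_ (∑-*ˡ N a f) (∑-*ˡ N b g))) (∑-*ˡ N c h))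

-- A linear bound on the number of ones

module Fox (m : ℕ) where

  -- s² < t is what makes the recursion ones(tN) ≤ s²·ones(N) + O(N) linear.
  s τ t c : ℕ
  s = 2 ^ m
  τ = 1 + (m + m)
  t = 2 ^ τ
  c = 2 * (t * t * (s * 4 ^ τ))

  open Blocks t

  -- Block `(q , p)` is wide when the contracted row `q` has at least `2 ^ m` ones among the `2 ^ τ`
  -- columns of block column `p`, so the halving bound applies with `l = m`.
  wide-count : ∀ N A p → ¬ Minor m m A → ∑ N (λ q → ι (wide s A q p)) ≤ s * 4 ^ τ
  wide-count N A p avoids = ≤-trans
    (rowMinor-bound τ m m (p * t) (contractRows A) (λ q → wide s A q p) N
      (λ q → ≤ᵇ⇒≤ _ _) (avoids ∘ contractRows-minor))
    -- The factor `m` is relaxed to `2 ^ m`, so that the final constant is a power of two.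
    (*-monoˡ-≤ (4 ^ τ) (<⇒≤ (m<2^m m)))

  -- For `N = t ^ e`, wide and tall blocks together cost at most `c * N` by the choice of `c`, and
  -- the remaining ones at most `s * s * (c * N)` by induction. The sum fits into `c * (t * N)`.
  ones-bound-pow : ∀ e A → ¬ Minor m m A → ones (t ^ e) A ≤ c * t ^ e
  ones-bound-pow zero A avoids = ≤-trans (ι≤1 _) (≤-trans 1≤c (≤-reflexive (sym (*-identityʳ c))))
    where
    1≤c : 1 ≤ c
    1≤c = *-mono-≤ {1} {2} (s≤s z≤n) (*-mono-≤ {1} (*-mono-≤ {1} (m^n>0 2 τ) (m^n>0 2 τ))
            (*-mono-≤ {1} (m^n>0 2 m) (m^n>0 4 τ)))
  ones-bound-pow (suc e) A avoids = begin
    ones (t * N) A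
      ≡⟨ cong (λ n → ones n A) (*-comm t N) ⟩
    ones (N * t) A
      ≡⟨ ones-blocks t N A ⟩
    ∑ N (λ q → ∑ N (λ p → weight A q p))
      ≤⟨ ∑-mono N (λ q → ∑-mono N (λ p → weight≤ s A q p)) ⟩
    ∑ N (λ q → ∑ N (λ p → t * t * ι (wide s A q p) + t * t * ι (wide s (flip A) p q)
                           + s * s * ι (contract A q p)))
      ≡⟨ ∑∑-linear N (t * t) (t * t) (s * s) _ _ _ ⟩
    t * t * ∑ N (λ q → ∑ N (λ p → ι (wide s A q p)))
      + t * t * ∑ N (λ q → ∑ N (λ p → ι (wide s (flip A) p q)))
      + s * s * ones N (contract A)
      ≤⟨ +-mono-≤ (+-mono-≤ (*-monoʳ-≤ (t * t) wides) (*-monoʳ-≤ (t * t) talls))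
           (*-monoʳ-≤ (s * s) (ones-bound-pow e (contract A) (avoids ∘ contract-minor))) ⟩
    t * t * (N * F) + t * t * (N * F) + s * s * (c * N)
      ≡⟨ collect (t * t) N F (s * s) ⟩
    c * ((1 + s * s) * N)
      ≤⟨ *-monoʳ-≤ c (*-monoˡ-≤ N 1+s²≤t) ⟩
    c * (t * N) ∎
    where
    open ≤-Reasoning
    N F : ℕ
    N = t ^ e
    F = s * 4 ^ τ
    wides : ∑ N (λ q → ∑ N (λ p → ι (wide s A q p))) ≤ N * F
    wides = ≤-trans (≤-reflexive (∑-swap N N _)) (∑-≤-const N F (λ p → wide-count N A p avoids))
    talls : ∑ N (λ q → ∑ N (λ p → ι (wide s (flip A) p q))) ≤ N * F
    talls = ∑-≤-const N F (λ q → wide-count N (flip A) q (avoids ∘ transposeMinor))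
    collect : ∀ T N F S →
      T * (N * F) + T * (N * F) + S * (2 * (T * F) * N) ≡ 2 * (T * F) * ((1 + S) * N)
    collect = solve-∀
    -- `t` is exactly twice `s * s`, and `s` is at least 1.
    1+s²≤t : 1 + s * s ≤ t
    1+s²≤t = ≤-trans (+-monoˡ-≤ (s * s) (*-mono-≤ {1} (m^n>0 2 m) (m^n>0 2 m)))
      (≤-reflexive (trans (cong (s * s +_) (sym (+-identityʳ (s * s))))
                          (cong (2 *_) (sym (^-distribˡ-+-* 2 m m)))))

  2≤t : 2 ≤ t
  2≤t = *-monoʳ-≤ 2 (m^n>0 2 (m + m))

  -- Rounding the side up to a power of `t` loses at most a factor `t`, which joins the constant.
  power-between : ∀ n → 1 ≤ n → ∃[ e ] (n ≤ t ^ e × t ^ e ≤ t * n)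
  power-between (suc zero) _ = 0 , ≤-refl , ≤-trans (≤-trans (s≤s z≤n) 2≤t) (≤-reflexive (sym (*-identityʳ t)))
  power-between (suc (suc n)) _ with power-between (suc n) (s≤s z≤n)
  ... | e , n≤ , ≤tn with 2+ n ≤? t ^ e
  ...   | yes p = e , p , ≤-trans ≤tn (*-monoʳ-≤ t (n≤1+n _))
  ...   | no  p = suc e , ≤-trans lower (*-monoʳ-≤ t n≤) , *-monoʳ-≤ t (<⇒≤ (≰⇒> p))
    where
    lower : 2+ n ≤ t * suc n
    lower = ≤-trans (≤-trans (+-monoʳ-≤ 2 (m≤n*m n 2)) (≤-reflexive (sym (*-suc 2 n)))) (*-monoˡ-≤ (suc n) 2≤t)

  -- As `4 ^ τ` is `t * t`, the product is 2 times `s` times the fifth power of `t`; the exponent is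
  -- 1 + m + 5(1 + 2m).
  constant : c * t ≡ 2 ^ (6 + 11 * m)
  constant = begin
    c * t
      ≡⟨ cong (λ x → 2 * (t * t * (s * x)) * t) 4^τ ⟩
    2 * (t * t * (s * (t * t))) * t
      ≡⟨ regroup t s ⟩
    2 ^ 1 * s * (t * t * t * t * t)
      ≡⟨ cong₂ _*_ (^-distribˡ-+-* 2 1 m) (fifth τ) ⟨
    2 ^ (1 + m) * 2 ^ (τ + τ + τ + τ + τ)
      ≡⟨ ^-distribˡ-+-* 2 (1 + m) (τ + τ + τ + τ + τ) ⟨
    2 ^ (1 + m + (τ + τ + τ + τ + τ))
      ≡⟨ cong (2 ^_) (exponent m) ⟩
    2 ^ (6 + 11 * m) ∎
    where
    open ≡-Reasoning
    4^τ : 4 ^ τ ≡ t * t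
    4^τ = trans (^-*-assoc 2 2 τ) (trans (cong (λ x → 2 ^ (τ + x)) (+-identityʳ τ)) (^-distribˡ-+-* 2 τ τ))
    regroup : ∀ t s → 2 * (t * t * (s * (t * t))) * t ≡ 2 ^ 1 * s * (t * t * t * t * t)
    regroup = solve-∀
    exponent : ∀ m → let τ = 1 + (m + m) in 1 + m + (τ + τ + τ + τ + τ) ≡ 6 + 11 * m
    exponent = solve-∀
    fifth : ∀ x → 2 ^ (x + x + x + x + x) ≡ 2 ^ x * 2 ^ x * 2 ^ x * 2 ^ x * 2 ^ x
    fifth x = trans (^-distribˡ-+-* 2 (x + x + x + x) x) (cong (_* 2 ^ x)
      (trans (^-distribˡ-+-* 2 (x + x + x) x) (cong (_* 2 ^ x)
      (trans (^-distribˡ-+-* 2 (x + x) x) (cong (_* 2 ^ x) (^-distribˡ-+-* 2 x x))))))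

  -- Matrices are total functions and avoidance concerns all of `A`, so the `n` by `n` corner can be
  -- enlarged to side `t ^ e` without padding.
  ones-bound : ∀ n A → ¬ Minor m m A → ones n A ≤ n * 2 ^ (6 + 11 * m)
  ones-bound zero    A avoids = z≤n
  ones-bound n@(suc _) A avoids with power-between n (s≤s z≤n)
  ... | e , n≤N , N≤tn = begin
    ones n A                             ≤⟨ ∑-widen _ n≤N ⟩
    ∑ (t ^ e) (λ r → ∑ n (λ c → ι (A r c)))  ≤⟨ ∑-mono (t ^ e) (λ r → ∑-widen _ n≤N) ⟩
    ones (t ^ e) A                       ≤⟨ ones-bound-pow e A avoids ⟩
    c * t ^ e                            ≤⟨ *-monoʳ-≤ c N≤tn ⟩
    c * (t * n)                          ≡⟨ *-assoc c t n ⟨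
    c * t * n                            ≡⟨ cong (_* n) constant ⟩
    2 ^ (6 + 11 * m) * n                 ≡⟨ *-comm _ n ⟩
    n * 2 ^ (6 + 11 * m)                 ∎
    where open ≤-Reasoning

-- Accesses captured by increasing touches

-- The first index counts members, not links; the second is the first member.
data Chain (R : ℕ → ℕ → Set) : ℕ → ℕ → Set where
  [_] : ∀ u → Chain R 1 u
  cons : ∀ {k u v} → R u v → Chain R k v → Chain R (suc k) u

chain-map : ∀ {R S : ℕ → ℕ → Set} → (∀ {u v} → R u v → S u v) → ∀ {k u} → Chain R k u → Chain S k u
chain-map f [ u ]       = [ u ]
chain-map f (cons r ch) = cons (f r) (chain-map f ch)

Between : ℕ → ℕ → ℕ → Set
Between x c y = (x ≤ c × c ≤ y) ⊎ (y ≤ c × c ≤ x)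

-- The properties of Greedy that the proof uses. Row r is time r + 1, a r is the key accessed and
-- M r b says that key b is touched.
record Execution (n : ℕ) (a : ℕ → ℕ) (M : Matrix) : Set where
  field
    row<n  : ∀ {r b} → T (M r b) → r < n
    access : ∀ {r} → r < n → T (M r (a r))
    -- The third condition puts the last point of column `b` before row `r` no later than row `r₀`,
    -- so a touch of `c` in row `r₀` would lie in the rectangle that Greedy found empty.
    empty  : ∀ {r r₀ b c} → T (M r b) → b ≢ a r → r₀ < r →
             (∀ r′ → r₀ < r′ → r′ < r → ¬ T (M r′ b)) →
             c ≢ b → Between (a r) c b → ¬ T (M r₀ c)

Descends : ℕ → (ℕ → ℕ) → ℕ → ℕ → Set
Descends n a u v = u < v × v < n × a v < a u

firstAfter : ∀ (p : ℕ → Bool) u r → u < r → T (p r) →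
  ∃[ v ] (u < v × v ≤ r × T (p v) × (∀ w → u < w → w < v → ¬ T (p w)))
firstAfter p u r u<r pr with m≤n⇒∃[o]m+o≡n u<r
... | d , refl = go d u pr
  where
  go : ∀ d u → T (p (suc u + d)) →
    ∃[ v ] (u < v × v ≤ suc u + d × T (p v) × (∀ w → u < w → w < v → ¬ T (p w)))
  go d u pr with T? (p (suc u))
  go d u pr | yes q = suc u , ≤-refl , m≤m+n _ _ , q , λ w u<w w<1+u → contradiction u<w (<⇒≱ w<1+u)
  go zero u pr | no ¬q = contradiction (subst (T ∘ p) (+-identityʳ (suc u)) pr) ¬q
  go (suc d) u pr | no ¬q with go d (suc u) (subst (T ∘ p) (+-suc (suc u) d) pr)
  ... | v , u<v , v≤ , pv , none =
    v , <-trans (n<1+n u) u<v , ≤-trans v≤ (≤-reflexive (sym (+-suc (suc u) d))) , pv , none′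
    where
    none′ : ∀ w → u < w → w < v → ¬ T (p w)
    none′ w u<w w<v with m≤n⇒m<n∨m≡n u<w
    ... | inj₁ 1+u<w = none w 1+u<w w<v
    ... | inj₂ refl  = ¬q

module Gadget {n a M} (ex : Execution n a M) where
  open Execution ex

  HasAccess : ℕ → ℕ → ℕ → ℕ → Set
  HasAccess r₁ r₂ c₁ c₂ = ∃[ u ] (u ∈[ r₁ , r₂ ⟩ × u < n × a u ∈[ c₁ , c₂ ⟩)

  -- An access left of x cannot cause the first touch of column c after time u: it would see (u , x).
  nextTouch : ∀ {r₁ r₂ c₁ c₂ u x r c} → T (M u x) → T (M r c) → r₁ ≤ u → u < r → r < r₂ →
    c₁ ≤ x → x < c → c < c₂ →
    HasAccess r₁ r₂ c₁ c₂ ⊎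
    (∃[ v ] (u < v × v ≤ r × T (M v c) × c₂ ≤ a v × (∀ {y} → c < y → y ≤ a v → ¬ T (M u y))))
  nextTouch {r₁} {r₂} {c₁} {c₂} {u} {x} {r} {c} Mux Mrc r₁≤u u<r r<r₂ c₁≤x x<c c<c₂
    with firstAfter (λ r → M r c) u r u<r Mrc
  ... | v , u<v , v≤r , Mvc , none with a v ≤? x | a v <? c₂
  ...   | no av≰x | yes av<c₂ = inj₁
    (v , (≤-trans r₁≤u (<⇒≤ u<v) , ≤-<-trans v≤r r<r₂) , row<n Mvc ,
     (≤-trans c₁≤x (<⇒≤ (≰⇒> av≰x)) , av<c₂))
  ...   | yes av≤x | _ = contradiction Mux
    (empty Mvc (λ { refl → <⇒≱ x<c av≤x }) u<v none (<⇒≢ x<c) (inj₁ (av≤x , <⇒≤ x<c)))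
  -- The same empty rectangle shows that row `u` has no touch right of `c` up to `a v`; this later
  -- forces `a v < a u`.
  ...   | no _ | no av≮c₂ = inj₂ (v , u<v , v≤r , Mvc , ≮⇒≥ av≮c₂ , λ c<y y≤av →
    empty Mvc (λ { refl → av≮c₂ c<c₂ }) u<v none (≢-sym (<⇒≢ c<y)) (inj₂ (<⇒≤ c<y , y≤av)))

  module _ (l : ℕ) (ρ γ : ℕ → ℕ) (ρ-mono : Monotone ρ) (γ-mono : Monotone γ)
    (cell : ∀ {j} → j < l →
            ∃[ r ] ∃[ c ] (r ∈[ ρ j , ρ (suc j) ⟩ × c ∈[ γ j , γ (suc j) ⟩ × T (M r c)))
    where

    -- `(u , x)` is the current point qᵢ, caused by an access right of the box. Each of the `d`
    -- remaining intervals supplies the next such point, whose access is again right of the box but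
    -- left of the previous access.
    captureFrom : ∀ d j {u x} → j + d ≡ l → T (M u x) → ρ 0 ≤ u → u < ρ j → γ 0 ≤ x → x < γ j →
      γ l ≤ a u → HasAccess (ρ 0) (ρ l) (γ 0) (γ l) ⊎ Chain (Descends n a) (suc d) u
    captureFrom zero j {u} _ _ _ _ _ _ _ = inj₂ [ u ]
    captureFrom (suc d) j {u} {x} refl Mux ρ₀≤u u<ρj γ₀≤x x<γj γl≤au
      with cell {j} j<l
      where
      j<l : j < j + suc d
      j<l = m<m+n j (s≤s z≤n)
    ... | r , c , (ρj≤r , r<) , (γj≤c , c<) , Mrc
      with nextTouch Mux Mrc ρ₀≤u (<-≤-trans u<ρj ρj≤r)
             (<-≤-trans r< (monotone⇒≤ ρ-mono {suc j} (m<m+n j (s≤s z≤n)))) γ₀≤x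
             (<-≤-trans x<γj γj≤c)
             (<-≤-trans c< (monotone⇒≤ γ-mono {suc j} (m<m+n j (s≤s z≤n))))
    ...   | inj₁ captured = inj₁ captured
    ...   | inj₂ (v , u<v , v≤r , Mvc , γl≤av , free)
      with captureFrom d (suc j) (sym (+-suc j d)) Mvc (≤-trans ρ₀≤u (<⇒≤ u<v)) (≤-<-trans v≤r r<)
             (≤-trans γ₀≤x (≤-trans (<⇒≤ x<γj) γj≤c)) c< γl≤av
    ...     | inj₁ captured = inj₁ captured
    ...     | inj₂ chain with a v <? a u
    ...       | yes av<au = inj₂ (cons (u<v , row<n Mvc , av<au) chain)
    -- Otherwise `a u` lies right of `c` and at most at `a v`, yet row `u` touches it, being its
    -- access.
    ...       | no  av≮au = contradiction (access (row<n Mux)) (free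
                  (<-≤-trans c< (≤-trans (monotone⇒≤ γ-mono {suc j} (m<m+n j (s≤s z≤n))) γl≤au))
                  (≮⇒≥ av≮au))

  -- Nothing is known about the access causing the first touch, so the chain starts with the second:
  -- `2+ k` intervals give `suc k` descending accesses.
  captures : ∀ k ρ γ → Monotone ρ → Monotone γ →
    (∀ {j} → j < 2+ k → ∃[ r ] ∃[ c ] (r ∈[ ρ j , ρ (suc j) ⟩ × c ∈[ γ j , γ (suc j) ⟩ × T (M r c))) →
    (∀ u → u < n → ¬ Chain (Descends n a) (suc k) u) → HasAccess (ρ 0) (ρ (2+ k)) (γ 0) (γ (2+ k))
  captures k ρ γ ρ-mono γ-mono cell noChain
    with cell {0} (s≤s z≤n) | cell {1} (s≤s (s≤s z≤n))
  ... | r₀ , c₀ , (ρ₀≤ , r₀<) , (γ₀≤ , c₀<) , M₀ | r , c , (ρ₁≤ , r<) , (γ₁≤ , c<) , M₁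
    with nextTouch M₀ M₁ ρ₀≤ (<-≤-trans r₀< ρ₁≤) (<-≤-trans r< (monotone⇒≤ ρ-mono (s≤s (s≤s z≤n))))
           γ₀≤ (<-≤-trans c₀< γ₁≤) (<-≤-trans c< (monotone⇒≤ γ-mono (s≤s (s≤s z≤n))))
  ... | inj₁ captured = captured
  ... | inj₂ (v , u<v , v≤r , Mvc , γl≤av , _)
    with captureFrom (2+ k) ρ γ ρ-mono γ-mono cell k 2 refl Mvc (≤-trans ρ₀≤ (<⇒≤ u<v))
           (≤-<-trans v≤r r<) (≤-trans (γ-mono 0) γ₁≤) c< γl≤av
  ... | inj₁ captured = captured
  ... | inj₂ chain    = contradiction chain (noChain v (row<n Mvc))

  module _ (k : ℕ) (minor : Minor (suc k * 2+ k) (suc k * 2+ k) M)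
    (noChain : ∀ u → u < n → ¬ Chain (Descends n a) (suc k) u) where
    open Minor minor

    l : ℕ
    l = 2+ k

    -- Only the diagonal cells of the block enter: their touches increase in both key and time.
    block : ∀ {i d} → i < suc k → d < suc k →
      HasAccess (ρ (i * l)) (ρ (suc i * l)) (γ (d * l)) (γ (suc d * l))
    block {i} {d} i<k d<k = subst₂ (λ x y → HasAccess (ρ (i * l)) (ρ x) (γ (d * l)) (γ y))
      (+-comm (i * l) l) (+-comm (d * l) l)
      (subst₂ (λ x y → HasAccess (ρ x) (ρ (i * l + l)) (γ y) (γ (d * l + l)))
        (+-identityʳ (i * l)) (+-identityʳ (d * l))
        (captures k (λ j → ρ (i * l + j)) (λ j → γ (d * l + j))
          (λ j → ≤-trans (ρ-mono _) (≤-reflexive (cong ρ (sym (+-suc (i * l) j)))))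
          (λ j → ≤-trans (γ-mono _) (≤-reflexive (cong γ (sym (+-suc (d * l) j)))))
          (λ {j} j<l →
            let (r , c , r∈ , c∈ , x) = cell (Blocks.inBlock l i<k j<l) (Blocks.inBlock l d<k j<l)
            in r , c , subst (λ z → r ∈[ ρ (i * l + j) , ρ z ⟩) (sym (+-suc (i * l) j)) r∈
                     , subst (λ z → c ∈[ γ (d * l + j) , γ z ⟩) (sym (+-suc (d * l) j)) c∈ , x)
          noChain))

    -- The blocks in row i and column d = k − i are in decreasing position.
    descent : ∀ d i → i + d ≡ k →
      ∃[ u ] (ρ (i * l) ≤ u × u < n × a u < γ (suc d * l) × Chain (Descends n a) (suc d) u)
    descent zero i eq =
      let (u , (ρ≤u , _) , u<n , (_ , au<)) =
            block {i} {0} (s≤s (≤-trans (m≤m+n i 0) (≤-reflexive eq))) (s≤s z≤n)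
      in u , ρ≤u , u<n , au< , [ u ]
    descent (suc d) i eq =
      let (u , (ρ≤u , u<) , u<n , (γ≤au , au<)) =
            block {i} {suc d} (s≤s (≤-trans (m≤m+n i (suc d)) (≤-reflexive eq)))
              (s≤s (≤-trans (m≤n+m (suc d) i) (≤-reflexive eq)))
          (v , ρ≤v , v<n , av< , chain) = descent d (suc i) (trans (sym (+-suc i d)) eq)
      in u , ρ≤u , u<n , au< , cons (<-≤-trans u< ρ≤v , v<n , <-≤-trans av< γ≤au) chain

  noMinor : ∀ k → (∀ u → u < n → ¬ Chain (Descends n a) (suc k) u) →
    ¬ Minor (suc k * 2+ k) (suc k * 2+ k) M
  noMinor k noChain minor =
    let (u , _ , u<n , _ , chain) = descent k minor noChain k 0 refl in noChain u u<n chain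

-- Bridges the offset between keys, which start at 1, and the columns counted by `ones`, which start
-- at 0.
shift-minor : ∀ {k l A} → Minor k l (λ r b → A r (suc b)) → Minor k l A
shift-minor m = record
  { ρ = ρ ; γ = suc ∘ γ ; ρ-mono = ρ-mono ; γ-mono = λ j → s≤s (γ-mono j)
  ; cell = λ i<k j<l → let (r , c , r∈ , (lo , hi) , x) = cell i<k j<l in
             r , suc c , r∈ , (s≤s lo , s≤s hi) , x }
  where open Minor m

execution-bound : ∀ {n a M} → Execution n a M → ∀ k →
  (∀ u → u < n → ¬ Chain (Descends n a) (suc k) u) →
  ones n (λ r b → M r (suc b)) ≤ n * 2 ^ (6 + 11 * (suc k * 2+ k))
execution-bound {n} ex k noChain =
  Fox.ones-bound (suc k * 2+ k) n _ (Gadget.noMinor ex k noChain ∘ shift-minor)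

-- Reflection of the key order

module Mirror {n a M} (ex : Execution n a M) (0<key : ∀ {r b} → T (M r b) → 0 < b) where
  open Execution ex

  a′ : ℕ → ℕ
  a′ r = suc n ∸ a r

  M′ : Matrix
  M′ r b = M r (suc n ∸ b)

  -- Beyond `n`, truncated subtraction sends `b` to column 0, which `0<key` keeps untouched.
  key≤n : ∀ {r b} → T (M′ r b) → b ≤ n
  key≤n {r} {b} h with b ≤? n
  ... | yes b≤n = b≤n
  ... | no  b≰n = contradiction (0<key h) (≤⇒≯ (≤-reflexive (m≤n⇒m∸n≡0 (≰⇒> b≰n))))

  -- On the keys up to `n` the reflection is undone by repeating it, and it swaps the two cases of
  -- `Between`, so emptiness transfers.
  mirror : (∀ {r} → a r ≤ n) → Execution n a′ M′
  mirror a≤n = record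
    { row<n  = row<n
    ; access = λ {r} r<n → subst (T ∘ M r) (sym (m∸[m∸n]≡n (m≤n⇒m≤1+n a≤n))) (access r<n)
    ; empty  = λ {r} {r₀} {b} {c} Mrb b≢a r₀<r none c≢b btw Mc →
        empty Mrb
          (λ eq → b≢a (trans (sym (m∸[m∸n]≡n (m≤n⇒m≤1+n (key≤n Mrb)))) (cong (suc n ∸_) eq)))
          r₀<r none
          (λ eq → c≢b (∸-cancelˡ-≡ (m≤n⇒m≤1+n (key≤n Mc)) (m≤n⇒m≤1+n (key≤n Mrb)) eq))
          (subst (λ x → Between x (suc n ∸ c) (suc n ∸ b)) (m∸[m∸n]≡n (m≤n⇒m≤1+n a≤n)) (flipped btw))
          Mc }
    where
    flipped : ∀ {x c y} → Between x c y → Between (suc n ∸ x) (suc n ∸ c) (suc n ∸ y)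
    flipped (inj₁ (p , q)) = inj₂ (∸-monoʳ-≤ (suc n) q , ∸-monoʳ-≤ (suc n) p)
    flipped (inj₂ (p , q)) = inj₁ (∸-monoʳ-≤ (suc n) q , ∸-monoʳ-≤ (suc n) p)

  -- The reflection permutes the columns 1 to `n`; `suc n ∸ suc i` computes to the `n ∸ i` of
  -- `∑-reverse`.
  ones-mirror : ones n (λ r b → M r (suc b)) ≡ ones n (λ r b → M′ r (suc b))
  ones-mirror = ∑-cong n (λ r → ∑-reverse n (ι ∘ M r))

-- Greedy as an execution

open import Data.Integer as ℤ using (ℤ; +_; +≤+)
import Data.Integer.Properties as ℤ
open import Data.List.Membership.DecPropositional (≡-dec _≟_ ℤ._≟_) using (_∈?_)

==ℕ⇒≡ : ∀ m n → T (m ==ℕ n) → m ≡ n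
==ℕ⇒≡ m n h with Equivalence.to (T-∧ {m ≤ᵇ n}) h
... | p , q = ≤-antisym (≤ᵇ⇒≤ m n p) (≤ᵇ⇒≤ n m q)

latest-∈ : ∀ P b {τ} → latest P b ≡ just τ → (b , τ) ∈ P
latest-∈ ((c , s) ∷ P) b eq with c ==ℕ b in c==b
... | false = there (latest-∈ P b eq)
... | true with ==ℕ⇒≡ c b (subst T (sym c==b) _) | latest P b in eq′
latest-∈ ((c , s) ∷ P) b refl | true | refl | nothing = here refl
latest-∈ ((c , s) ∷ P) b refl | true | refl | just u with ℤ.⊔-sel s u
... | inj₁ p = here (cong (b ,_) p)
... | inj₂ p = there (subst (λ τ → (b , τ) ∈ P) (sym p) (latest-∈ P b eq′))

allB-∈ : ∀ {A : Set} (p : A → Bool) {x xs} → T (allB p xs) → x ∈ xs → T (p x)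
allB-∈ p {xs = x ∷ xs} h (here refl) = proj₁ (Equivalence.to (T-∧ {p x}) h)
allB-∈ p {xs = y ∷ xs} h (there x∈)  = allB-∈ p (proj₂ (Equivalence.to (T-∧ {p y}) h)) x∈

not∨ : ∀ {x y} → T x → T (not x ∨ y) → T y
not∨ {true} _ h = h

emptyRect⇒∉ : ∀ {P a b c t s u} → T (emptyRect P (a , t) (b , s)) → c ≢ b → Between a c b →
  s ℤ.≤ u → u ℤ.≤ t → ¬ (c , u) ∈ P
emptyRect⇒∉ {P} {a} {b} {c} {t} {s} {u} h c≢b btw s≤u u≤t cu∈P =
  c≢b (==ℕ⇒≡ c b (proj₁ (Equivalence.to (T-∧ {c ==ℕ b}) same)))
  where
  lower : Between a c b → a ⊓ b ≤ c
  lower (inj₁ (a≤c , _)) = ≤-trans (m⊓n≤m a b) a≤c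
  lower (inj₂ (b≤c , _)) = ≤-trans (m⊓n≤n a b) b≤c
  upper : Between a c b → c ≤ a ⊔ b
  upper (inj₁ (_ , c≤b)) = ≤-trans c≤b (m≤n⊔m a b)
  upper (inj₂ (_ , c≤a)) = ≤-trans c≤a (m≤m⊔n a b)
  inside : T (inRect (a , t) (b , s) (c , u))
  inside = Equivalence.from T-∧ (≤⇒≤ᵇ (lower btw) , Equivalence.from T-∧ (≤⇒≤ᵇ (upper btw) ,
    Equivalence.from T-∧ (ℤ.≤⇒≤ᵇ (ℤ.≤-trans (ℤ.i⊓j≤j t s) s≤u) ,
                          ℤ.≤⇒≤ᵇ (ℤ.≤-trans u≤t (ℤ.i≤i⊔j t s)))))
  same : T (samePoint (c , u) (b , s))
  same = not∨ inside
    (allB-∈ (λ r → not (inRect (a , t) (b , s) r) ∨ samePoint r (b , s)) h cu∈P)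

-- The decision made by the local `step` of `touched`, separated from the accumulator so that
-- `touched` can be seen as a filter.
hit : List Point → ℕ → ℤ → ℕ → Bool
hit P a t b with b ==ℕ a | latest P b
... | true  | _       = false
... | false | nothing = false
... | false | just τ  = emptyRect P (a , t) (b , τ)

hit⇒emptyRect : ∀ P a t b → T (hit P a t b) →
  ∃[ τ ] ((b , τ) ∈ P × T (emptyRect P (a , t) (b , τ)))
hit⇒emptyRect P a t b h with b ==ℕ a | latest P b in eq
... | false | just τ = τ , latest-∈ P b eq , h

-- Gives access to the local function step of touched.
touched-foldr : ∀ n P a t → Σ (ℕ → List Point → List Point)
  (λ step → touched n P a t ≡ foldr step [] (applyUpTo suc n))
touched-foldr n P a t = _ , refl

step≡ : ∀ n P a t b acc → proj₁ (touched-foldr n P a t) b acc ≡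
  (if hit P a t b then (b , t) ∷ acc else acc)
step≡ n P a t b acc with b ==ℕ a | latest P b
... | true  | _       = refl
... | false | nothing = refl
... | false | just τ  = refl

touched≡ : ∀ n P a t → touched n P a t ≡ map (_, t) (filterᵇ (hit P a t) (applyUpTo suc n))
touched≡ n P a t = go (applyUpTo suc n)
  where
  go : ∀ bs → foldr (proj₁ (touched-foldr n P a t)) [] bs ≡ map (_, t) (filterᵇ (hit P a t) bs)
  go [] = refl
  go (b ∷ bs) rewrite step≡ n P a t b (foldr (proj₁ (touched-foldr n P a t)) [] bs) | go bs
    with hit P a t b
  ... | true  = refl
  ... | false = refl

∈-touched⁻ : ∀ n P a t {b s} → (b , s) ∈ touched n P a t →
  0 < b × s ≡ t × T (hit P a t b)
∈-touched⁻ n P a t {b} {s} b∈ rewrite touched≡ n P a t with ∈-map⁻ (_, t) b∈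
... | b′ , b′∈ , refl with ∈-filter⁻ (T? ∘ hit P a t) {xs = applyUpTo suc n} b′∈
... | b∈′ , h with ∈-applyUpTo⁻ suc b∈′
... | _ , _ , refl = s≤s z≤n , refl , h

∈-touched⁺ : ∀ n P a t {b} → b < n → T (hit P a t (suc b)) → (suc b , t) ∈ touched n P a t
∈-touched⁺ n P a t b<n h rewrite touched≡ n P a t =
  ∈-map⁺ (_, t) (∈-filter⁺ (T? ∘ hit P a t) (∈-applyUpTo⁺ suc b<n) h)

length-filterᵇ-applyUpTo : ∀ (p : ℕ → Bool) f n → length (filterᵇ p (applyUpTo f n)) ≡ ∑ n (ι ∘ p ∘ f)
length-filterᵇ-applyUpTo p f zero    = refl
length-filterᵇ-applyUpTo p f (suc n) rewrite ∑-head n (ι ∘ p ∘ f) with p (f 0)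
... | true  = cong suc (length-filterᵇ-applyUpTo p (f ∘ suc) n)
... | false = length-filterᵇ-applyUpTo p (f ∘ suc) n

length-touched : ∀ n P a t → length (touched n P a t) ≡ ∑ n (ι ∘ hit P a t ∘ suc)
length-touched n P a t rewrite touched≡ n P a t =
  trans (length-map (_, t) (filterᵇ (hit P a t) (applyUpTo suc n)))
        (length-filterᵇ-applyUpTo (hit P a t) suc n)

-- The times are 1 - d + j with j at most d. The bound 1 suffices because row 0 already has time 1,
-- so no row precedes a tree point.
treePoints-time≤1 : ∀ d dx t {b s} → (b , s) ∈ treePointsAt d dx t → s ℤ.≤ + 1
treePoints-time≤1 d dx (node l x r) b∈ with ∈-++⁻ (treePointsAt d (suc dx) l) b∈
... | inj₁ b∈l = treePoints-time≤1 d (suc dx) l b∈l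
... | inj₂ b∈′ with ∈-++⁻ (applyUpTo (λ j → x , ((+ 1) ℤ.- (+ d)) ℤ.+ (+ j)) (suc (d ∸ dx))) b∈′
...   | inj₂ b∈r = treePoints-time≤1 d (suc dx) r b∈r
...   | inj₁ b∈x with ∈-applyUpTo⁻ (λ j → x , ((+ 1) ℤ.- (+ d)) ℤ.+ (+ j)) b∈x
...     | j , j< , refl = ℤ.≤-trans
  (ℤ.+-monoʳ-≤ (+ 1 ℤ.- + d) (+≤+ (≤-trans (s≤s⁻¹ j<) (m∸n≤m d dx))))
  (ℤ.≤-reflexive (trans (ℤ.+-assoc (+ 1) (ℤ.- + d) (+ d))
                        (cong (ℤ._+_ (+ 1)) (ℤ.+-inverseˡ (+ d)))))

module Run (n : ℕ) (T₀ : Tree) (a : ℕ → ℕ) where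

  mutual
    history : ℕ → List Point
    history zero    = treePoints T₀
    history (suc r) = output r ++ history r

    output : ℕ → List Point
    output r = (a r , + suc r) ∷ touched n (history r) (a r) (+ suc r)

  output⊆history : ∀ {r r′ p} → r < r′ → p ∈ output r → p ∈ history r′
  output⊆history {r} {suc r′} r<1+r′ p∈ with m<1+n⇒m<n∨m≡n r<1+r′
  ... | inj₁ r<r′ = ∈-++⁺ʳ (output r′) (output⊆history r<r′ p∈)
  ... | inj₂ refl = ∈-++⁺ˡ p∈

  output-time : ∀ {r b s} → (b , s) ∈ output r → s ≡ + suc r
  output-time (here refl) = refl
  output-time {r} (there b∈) = proj₁ (proj₂ (∈-touched⁻ n (history r) (a r) (+ suc r) b∈))

  output-hit : ∀ {r b s} → (b , s) ∈ output r → b ≢ a r → T (hit (history r) (a r) (+ suc r) b)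
  output-hit (here refl) b≢a = contradiction refl b≢a
  output-hit {r} (there b∈) _ = proj₂ (proj₂ (∈-touched⁻ n (history r) (a r) (+ suc r) b∈))

  history-origin : ∀ r {b s} → (b , s) ∈ history r →
    s ℤ.≤ + 1 ⊎ ∃[ r′ ] (r′ < r × s ≡ + suc r′ × (b , + suc r′) ∈ output r′)
  history-origin zero b∈ = inj₁ (treePoints-time≤1 (height T₀) 1 T₀ b∈)
  history-origin (suc r) b∈ with ∈-++⁻ (output r) b∈
  ... | inj₁ b∈r with output-time {r} b∈r
  ...   | refl = inj₂ (r , ≤-refl , refl , b∈r)
  history-origin (suc r) b∈ | inj₂ b∈h with history-origin r b∈h
  ...   | inj₁ s≤1 = inj₁ s≤1
  ...   | inj₂ (r′ , r′<r , eq , b∈r′) = inj₂ (r′ , m≤n⇒m≤1+n r′<r , eq , b∈r′)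

  -- The run continues past row `n` on whatever values `a` has there; the test `r <? n` discards
  -- those rows.
  touch : Matrix
  touch r b = isYes ((r <? n) ×-dec ((b , + suc r) ∈? output r))

  touch⁻ : ∀ {r b} → T (touch r b) → r < n × (b , + suc r) ∈ output r
  touch⁻ {r} {b} = toWitness {a? = (r <? n) ×-dec ((b , + suc r) ∈? output r)}

  touch⁺ : ∀ {r b} → r < n → (b , + suc r) ∈ output r → T (touch r b)
  touch⁺ {r} {b} r<n b∈ = fromWitness {a? = (r <? n) ×-dec ((b , + suc r) ∈? output r)} (r<n , b∈)

  execution : Execution n a touch
  execution = record
    { row<n  = proj₁ ∘ touch⁻
    ; access = λ r<n → touch⁺ r<n (here refl)
    ; empty  = empty }
    where
    empty : ∀ {r r₀ b c} → T (touch r b) → b ≢ a r → r₀ < r →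
      (∀ r′ → r₀ < r′ → r′ < r → ¬ T (touch r′ b)) →
      c ≢ b → Between (a r) c b → ¬ T (touch r₀ c)
    empty {r} {r₀} {b} {c} rb b≢a r₀<r none c≢b btw r₀c
      with hit⇒emptyRect (history r) (a r) (+ suc r) b (output-hit {r} (proj₂ (touch⁻ rb)) b≢a)
    -- The corner is no later than row `r₀`: tree points have time at most 1, and an output point of
    -- column `b` after row `r₀` would contradict `none`.
    ... | τ , bτ∈ , emp = emptyRect⇒∉ {history r} emp c≢b btw (τ≤ (history-origin r bτ∈))
      (+≤+ (s≤s (<⇒≤ r₀<r))) (output⊆history r₀<r (proj₂ (touch⁻ r₀c)))
      where
      τ≤ : τ ℤ.≤ + 1 ⊎ ∃[ r′ ] (r′ < r × τ ≡ + suc r′ × (b , + suc r′) ∈ output r′) →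
        τ ℤ.≤ + suc r₀
      τ≤ (inj₁ τ≤1) = ℤ.≤-trans τ≤1 (+≤+ (s≤s z≤n))
      τ≤ (inj₂ (r′ , r′<r , refl , b∈)) with r′ ≤? r₀
      ... | yes r′≤r₀ = +≤+ (s≤s r′≤r₀)
      ... | no  r′≰r₀ = contradiction (touch⁺ (<-trans r′<r (proj₁ (touch⁻ rb))) b∈)
                          (none r′ (≰⇒> r′≰r₀) r′<r)

  0<key : (∀ {r} → r < n → 0 < a r) → ∀ {r b} → T (touch r b) → 0 < b
  0<key 0<a {r} h with touch⁻ h
  ... | r<n , here refl = 0<a r<n
  ... | _   , there b∈  = proj₁ (∈-touched⁻ n (history r) (a r) (+ suc r) b∈)

  -- `history` and `output` unfold exactly as the accumulator of `greedyFrom` does; only the access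
  -- sequence has to be reindexed.
  length-greedyFrom : ∀ r m f → (∀ i → f i ≡ a (r + i)) →
    length (greedyFrom n (history r) (suc r) (applyUpTo f m)) ≡ ∑ m (λ i → length (output (r + i)))
  length-greedyFrom r zero    f f≡ = refl
  length-greedyFrom r (suc m) f f≡ rewrite trans (f≡ 0) (cong a (+-identityʳ r)) = begin
    length (output r ++ rest)                           ≡⟨ length-++ (output r) ⟩
    length (output r) + length rest                     ≡⟨ cong₂ _+_ (cong (length ∘ output) (sym (+-identityʳ r)))
      (trans (length-greedyFrom (suc r) m (f ∘ suc) (λ i → trans (f≡ (suc i)) (cong a (+-suc r i))))
             (∑-cong m (λ i → cong (length ∘ output) (sym (+-suc r i))))) ⟩
    length (output (r + 0)) + ∑ m (λ i → length (output (r + suc i)))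
      ≡⟨ ∑-head m (λ i → length (output (r + i))) ⟨
    ∑ (suc m) (λ i → length (output (r + i)))           ∎
    where
    open ≡-Reasoning
    rest : List Point
    rest = greedyFrom n (history (suc r)) (suc (suc r)) (applyUpTo (f ∘ suc) m)

  length-greedy≤ : length (greedyFrom n (treePoints T₀) 1 (applyUpTo a n)) ≤
    n + ones n (λ r b → touch r (suc b))
  length-greedy≤ = begin
    length (greedyFrom n (treePoints T₀) 1 (applyUpTo a n))
      ≡⟨ length-greedyFrom 0 n a (λ _ → refl) ⟩
    ∑ n (length ∘ output)
      -- The access of each row is counted apart here and may be counted again in `ones`, at the
      -- price of the extra `n`.
      ≤⟨ ∑-mono-< n (λ r r<n → s≤s (≤-trans
           (≤-reflexive (length-touched n (history r) (a r) (+ suc r)))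
           (∑-mono-< n (λ b b<n → ι≤ (λ h → T⇒1≤ι (touch⁺ r<n (there
             (∈-touched⁺ n (history r) (a r) (+ suc r) b<n h)))))))) ⟩
    ∑ n (λ r → 1 + ∑ n (λ b → ι (touch r (suc b))))
      ≡⟨ ∑-+ n (λ _ → 1) _ ⟩
    ∑ n (λ _ → 1) + ones n (λ r b → touch r (suc b))
      ≤⟨ +-monoˡ-≤ _ (≤-trans (∑-≤-const n 1 (λ _ → ≤-refl)) (≤-reflexive (*-identityʳ n))) ⟩
    n + ones n (λ r b → touch r (suc b)) ∎
    where open ≤-Reasoning

-- Junk value 0 outside the domain.
extend : ∀ {n} → (Fin n → ℕ) → ℕ → ℕ
extend {n} f r with r <? n
... | yes r<n = f (fromℕ< r<n)
... | no  _   = 0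

extend-< : ∀ {n} (f : Fin n → ℕ) {r} (r<n : r < n) → extend f r ≡ f (fromℕ< r<n)
extend-< {n} f {r} r<n with r <? n
... | yes p = cong f (Fin.fromℕ<-cong r r refl p r<n)
... | no  q = contradiction r<n q

extend-toℕ : ∀ {n} (f : Fin n → ℕ) i → extend f (toℕ i) ≡ f i
extend-toℕ f i = trans (extend-< f (Fin.toℕ<n i)) (cong f (Fin.fromℕ<-toℕ i (Fin.toℕ<n i)))

tabulate≡applyUpTo : ∀ {n} (f : Fin n → ℕ) g → (∀ i → f i ≡ g (toℕ i)) → tabulate f ≡ applyUpTo g n
tabulate≡applyUpTo {zero}  f g h = refl
tabulate≡applyUpTo {suc n} f g h =
  cong₂ _∷_ (h Fin.zero) (tabulate≡applyUpTo (f ∘ Fin.suc) (g ∘ suc) (h ∘ Fin.suc))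

map-allFin : ∀ {n} (f : Fin n → ℕ) → map f (allFin n) ≡ applyUpTo (extend f) n
map-allFin f = trans (map-tabulate id f) (tabulate≡applyUpTo f (extend f) (sym ∘ extend-toℕ f))

-- Chains of accesses as pattern occurrences

module _ {R : ℕ → ℕ → Set} where

  nth : ∀ {k u} → Chain R k u → Fin k → ℕ
  nth [ u ]            _           = u
  nth (cons {u = u} _ _) Fin.zero  = u
  nth (cons _ ch)      (Fin.suc i) = nth ch i

  module _ (R-trans : ∀ {u v w} → R u v → R v w → R u w) where

    nth-head : ∀ {k u v} → R u v → (ch : Chain R k v) → ∀ i → R u (nth ch i)
    nth-head r [ v ]         i           = r
    nth-head r (cons _ _)    Fin.zero    = r
    nth-head r (cons r′ ch)  (Fin.suc i) = nth-head (R-trans r r′) ch i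

    nth-< : ∀ {k u} (ch : Chain R k u) {i j} → i Fin.< j → R (nth ch i) (nth ch j)
    nth-< [ u ]       {Fin.zero}  {Fin.zero}  ()
    nth-< (cons r ch) {Fin.zero}  {Fin.suc j} _   = nth-head r ch j
    nth-< (cons r ch) {Fin.suc i} {Fin.suc j} i<j = nth-< ch (s≤s⁻¹ i<j)

nth-all : ∀ {R : ℕ → ℕ → Set} {P : ℕ → Set} → (∀ {u v} → R u v → P v) →
  ∀ {k u} → P u → (ch : Chain R k u) → ∀ i → P (nth ch i)
nth-all R⇒P p [ u ]       i           = p
nth-all R⇒P p (cons _ _)  Fin.zero    = p
nth-all R⇒P p (cons r ch) (Fin.suc i) = nth-all R⇒P (R⇒P r) ch i

-- Used twice with `x` and `π` exchanged to get an equivalence. The order is a parameter because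
-- decreasing patterns need the reversed order of indices.
<-reflected : ∀ {k} {x π : Fin k → ℕ} {_⊏_ : Fin k → Fin k → Set} →
  (∀ i j → i ⊏ j ⊎ i ≡ j ⊎ j ⊏ i) → (∀ {i j} → i ⊏ j → x i < x j) → (∀ {i j} → i ⊏ j → π i < π j) →
  ∀ i j → x i < x j → π i < π j
<-reflected total x-mono π-mono i j xi<xj with total i j
... | inj₁ i⊏j         = π-mono i⊏j
... | inj₂ (inj₁ refl) = contradiction xi<xj (<-irrefl refl)
... | inj₂ (inj₂ j⊏i)  = contradiction xi<xj (<-asym (x-mono j⊏i))

Fin-<-total : ∀ {k} (i j : Fin k) → i Fin.< j ⊎ i ≡ j ⊎ j Fin.< i
Fin-<-total i j with Fin.<-cmp i j
... | tri< p _ _ = inj₁ p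
... | tri≈ _ p _ = inj₂ (inj₁ p)
... | tri> _ _ p = inj₂ (inj₂ p)

Ascends : ℕ → (ℕ → ℕ) → ℕ → ℕ → Set
Ascends n a u v = u < v × v < n × a u < a v

module _ {n : ℕ} (x : Fin n → ℕ) where

  private
    a : ℕ → ℕ
    a = extend x

  module Positions {R : ℕ → ℕ → Set} (R⇒< : ∀ {u v} → R u v → u < v) (R⇒<n : ∀ {u v} → R u v → v < n)
    (R-trans : ∀ {u v w} → R u v → R v w → R u w) {k u} (u<n : u < n) (ch : Chain R k u) where

    position : Fin k → Fin n
    position i = fromℕ< (nth-all R⇒<n u<n ch i)

    position-< : ∀ i j → i Fin.< j → position i Fin.< position j
    position-< i j i<j = subst₂ _<_ (sym (Fin.toℕ-fromℕ< _)) (sym (Fin.toℕ-fromℕ< _))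
      (R⇒< (nth-< R-trans ch i<j))

    value : ∀ i → a (nth ch i) ≡ x (position i)
    value i = extend-< x (nth-all R⇒<n u<n ch i)

  descent⇒contains : ∀ {k u} → u < n → Chain (Descends n a) k u → Contains x (decPattern k)
  descent⇒contains {k} u<n ch = position , position-< , λ i j →
    mk⇔ (<-reflected total x-anti π-anti i j) (<-reflected total π-anti x-anti i j)
    where
    open Positions (λ (p , _) → p) (λ (_ , p , _) → p)
      (λ (p , _ , q) (p′ , w<n , q′) → <-trans p p′ , w<n , <-trans q′ q) u<n ch
    total : ∀ i j → j Fin.< i ⊎ i ≡ j ⊎ i Fin.< j
    total i j with Fin-<-total i j
    ... | inj₁ p        = inj₂ (inj₂ p)
    ... | inj₂ (inj₁ p) = inj₂ (inj₁ p)
    ... | inj₂ (inj₂ p) = inj₁ p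
    x-anti : ∀ {i j} → j Fin.< i → x (position i) < x (position j)
    x-anti {i} {j} j<i = subst₂ _<_ (value i) (value j)
      (proj₂ (proj₂ (nth-< (λ (p , _ , q) (p′ , w<n , q′) → <-trans p p′ , w<n , <-trans q′ q) ch j<i)))
    π-anti : ∀ {i j} → j Fin.< i → decPattern k i < decPattern k j
    -- Truncation does no harm, since indices stay below `k`.
    π-anti {i} {j} j<i = ∸-monoʳ-< j<i (<⇒≤ (Fin.toℕ<n i))

  ascent⇒contains : ∀ {k u} → u < n → Chain (Ascends n a) k u → Contains x (incPattern k)
  ascent⇒contains {k} u<n ch = position , position-< , λ i j →
    mk⇔ (<-reflected Fin-<-total x-mono s≤s i j) (<-reflected Fin-<-total s≤s x-mono i j)
    where
    open Positions (λ (p , _) → p) (λ (_ , p , _) → p)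
      (λ (p , _ , q) (p′ , w<n , q′) → <-trans p p′ , w<n , <-trans q q′) u<n ch
    x-mono : ∀ {i j} → i Fin.< j → x (position i) < x (position j)
    x-mono {i} {j} i<j = subst₂ _<_ (value i) (value j)
      (proj₂ (proj₂ (nth-< (λ (p , _ , q) (p′ , w<n , q′) → <-trans p p′ , w<n , <-trans q q′) ch i<j)))

-- The cost bound for both patterns

module _ {n : ℕ} (X : Permutation′ n) (T₀ : Tree) where

  private
    a : ℕ → ℕ
    a = extend (seqOf X)
  open Run n T₀ a

  a≤n : ∀ {r} → a r ≤ n
  a≤n {r} with r <? n
  ... | yes _ = Fin.toℕ<n _
  ... | no  _ = z≤n

  0<a : ∀ {r} → r < n → 0 < a r
  0<a {r} r<n with r <? n
  ... | yes _ = s≤s z≤n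
  ... | no  q = contradiction r<n q

  cost≤ : greedyCost T₀ X ≤ n + ones n (λ r b → touch r (suc b))
  cost≤ = subst (λ as → length (greedyFrom n (treePoints T₀) 1 as) ≤ n + ones n (λ r b → touch r (suc b)))
    (sym (map-allFin (seqOf X))) length-greedy≤

  ones-decreasing-avoiding : ∀ k → Avoids (seqOf X) (decPattern (suc k)) →
    ones n (λ r b → touch r (suc b)) ≤ n * 2 ^ (6 + 11 * (suc k * 2+ k))
  ones-decreasing-avoiding k avoids =
    execution-bound execution k (λ u u<n ch → avoids (descent⇒contains (seqOf X) u<n ch))

  -- A descending chain of the mirrored accesses is an ascending chain of the original ones, so the
  -- mirrored execution satisfies the hypothesis of `execution-bound`.
  ones-increasing-avoiding : ∀ k → Avoids (seqOf X) (incPattern (suc k)) →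
    ones n (λ r b → touch r (suc b)) ≤ n * 2 ^ (6 + 11 * (suc k * 2+ k))
  ones-increasing-avoiding k avoids = ≤-trans (≤-reflexive ones-mirror)
    (execution-bound (mirror a≤n) k (λ u u<n ch →
      avoids (ascent⇒contains (seqOf X) u<n (chain-map ascends ch))))
    where
    open Mirror execution (0<key 0<a)
    ascends : ∀ {u v} → Descends n a′ u v → Ascends n a u v
    ascends {u} {v} (u<v , v<n , a′v<a′u) = u<v , v<n , ∸-cancelʳ-< {a v} {a u} a′v<a′u

-- Settles `k = 0`, where avoidance is contradictory.
contains-empty : ∀ {n} (x : Fin n → ℕ) (π : Fin 0 → ℕ) → Contains x π
contains-empty x π = (λ ()) , (λ ()) , (λ ())

-- The constant 29 is 1 + 6 + 11 * 2, the exponent at `k = 0`; for larger `k` the slack is the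
-- polynomial 18k² + 25k.
absorb : ∀ n k → n + n * 2 ^ (6 + 11 * (suc k * 2+ k)) ≤ n * 2 ^ (29 * (suc k * suc k))
absorb n k = begin
  n + n * 2 ^ e      ≤⟨ +-monoˡ-≤ (n * 2 ^ e) (m≤m*n n (2 ^ e) {{m^n≢0 2 e}}) ⟩
  n * 2 ^ e + n * 2 ^ e  ≡⟨ double n (2 ^ e) ⟩
  n * 2 ^ (1 + e)    ≤⟨ *-monoʳ-≤ n (^-monoʳ-≤ 2 (≤-trans (m≤m+n (1 + e) (18 * (k * k) + 25 * k)) (≤-reflexive (exponent k)))) ⟩
  n * 2 ^ (29 * (suc k * suc k)) ∎
  where
  open ≤-Reasoning
  e : ℕ
  e = 6 + 11 * (suc k * 2+ k)
  double : ∀ n x → n * x + n * x ≡ n * (2 * x)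
  double = solve-∀
  exponent : ∀ k → 1 + (6 + 11 * ((1 + k) * (2 + k))) + (18 * (k * k) + 25 * k) ≡ 29 * ((1 + k) * (1 + k))
  exponent = solve-∀

mainTheorem6 : ∃[ C ] ((k n : ℕ) (X : Permutation′ n) (T : Tree) →
    IsBSTOn n T →
    (Avoids (seqOf X) (decPattern k) ⊎ Avoids (seqOf X) (incPattern k)) →
    greedyCost T X ≤ n * 2 ^ (C * (k * k)))
mainTheorem6 = 29 , λ
  { zero    n X T₀ _ (inj₁ avoids) → contradiction (contains-empty (seqOf X) (decPattern 0)) avoids
  ; zero    n X T₀ _ (inj₂ avoids) → contradiction (contains-empty (seqOf X) (incPattern 0)) avoids
  ; (suc k) n X T₀ _ (inj₁ avoids) →
      ≤-trans (cost≤ X T₀) (≤-trans (+-monoʳ-≤ n (ones-decreasing-avoiding X T₀ k avoids)) (absorb n k))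
  ; (suc k) n X T₀ _ (inj₂ avoids) →
      ≤-trans (cost≤ X T₀) (≤-trans (+-monoʳ-≤ n (ones-increasing-avoiding X T₀ k avoids)) (absorb n k)) }
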